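{- Let $S\subseteq (0,1)$ be a nonempty set. Then there exist a maximal $\mathsf{d}$-independent family $\mathcal{A}$ of cardinality $\mathfrak{c}$ and an at most countable subfamily $\mathcal{B}\subseteq \mathcal{A}$ such that $$\mathsf{d}[\mathcal{A}\setminus \mathcal{B}]=S \qquad\text{and}\qquad \mathsf{d}[\mathcal{B}]'\subseteq \{0,1\}.$$
   Context: Let $\omega=\{0,1,2,\ldots\}$ and identify $n\in\omega$ with $\{0,\ldots,n-1\}$. $\mathcal{D}$ is the family of all $A\subseteq\omega$ for which the asymptotic density $\mathsf{d}(A):=\lim_{n\to\infty}|A\cap n|/n$ exists. For $\mathcal{A}\subseteq\mathcal{P}(\omega)$, $\langle\mathcal{A}\rangle$ denotes the field of subsets of $\omega$ generated by $\mathcal{A}$. For $\mathcal{F}\subseteq\mathcal{D}$, $\mathsf{d}[\mathcal{F}]:=\{\mathsf{d}(A):A\in\mathcal{F}\}$. A nonempty family $\mathcal{A}\subseteq\mathcal{D}$ is $\mathsf{d}$-independent if: (1) $\mathsf{d}(A)\in(0,1)$ for all $A\in\mathcal{A}$; (2) $\langle\mathcal{A}\rangle\subseteq\mathcal{D}$; (3) $\mathsf{d}(\bigcap\mathcal{F})=\prod_{A\in\mathcal{F}}\mathsf{d}(A)$ for every nonempty finite $\mathcal{F}\subseteq\mathcal{A}$. It is a maximal $\mathsf{d}$-independent family if it is $\mathsf{d}$-independent and not properly contained in another $\mathsf{d}$-independent family. For $X\subseteq\mathbb{R}$, $X'$ denotes the set of accumulation points of $X$ in $\mathbb{R}$. $\mathfrak{c}=2^{\aleph_0}$.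 -}

module Defs where

open import Algebra.Bundles using (CommutativeMonoid)
import Algebra.Properties.AbelianGroup as AbelianGroupProperties
import Algebra.Properties.CommutativeSemigroup as CommutativeSemigroupProperties
import Algebra.Properties.Group as GroupProperties
open import Data.Bool.Base using (Bool; true; false; not; _∧_; _∨_; if_then_else_)
import Data.Integer.Base as ℤ
open import Data.List.Base using (List; []; _∷_; foldr)
open import Data.List.Relation.Binary.Pointwise using (Pointwise)
open import Data.List.Relation.Unary.All using (All)
import Data.List.Relation.Unary.Unique.Setoid as UniqueSetoid
open import Data.Nat.Base as ℕ using (ℕ; zero; suc)
import Data.Nat.Properties as ℕ
open import Data.Product.Base using (Σ; ∃; _×_; _,_; proj₁)
open import Data.Rational.Base as ℚ
  using (ℚ; 0ℚ; 1ℚ; ½; _+_; _-_; -_; _*_; ∣_∣; _≤_; _<_; 1/_; Positive)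
import Data.Rational.Properties as ℚ
open import Data.Sum.Base using (_⊎_; inj₁; inj₂)
open import Function.Bundles using (Bijection; Injection)
open import Level using (0ℓ)
open import Relation.Binary.Bundles using (Setoid)
import Relation.Binary.Construct.On as On
open import Relation.Binary.PropositionalEquality
  using (_≡_; refl; sym; trans; cong; cong₂; subst; setoid; _→-setoid_)
open import Relation.Nullary.Negation.Core using (¬_)
open import Relation.Unary using (Pred; _∈_; _⊆_; Satisfiable)

------------------------------------------------------------------------
-- The real numbers, as Cauchy sequences of rationals up to _≈ᴿ_

Cauchy : (ℕ → ℚ) → Set
Cauchy u = ∀ ε → 0ℚ < ε →
  ∃ λ N → ∀ m n → N ℕ.≤ m → N ℕ.≤ n → ∣ u m - u n ∣ < ε

record ℝ : Set where
  constructor mkℝ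
  field
    seq    : ℕ → ℚ
    cauchy : Cauchy seq

open ℝ public

infix 4 _≈ᴿ_ _<ᴿ_

_≈ᴿ_ : ℝ → ℝ → Set
x ≈ᴿ y = ∀ ε → 0ℚ < ε →
  ∃ λ N → ∀ n → N ℕ.≤ n → ∣ seq x n - seq y n ∣ < ε

-- The sequences are eventually separated by a fixed positive rational;
-- eventual termwise inequality alone would not be invariant under _≈ᴿ_.
_<ᴿ_ : ℝ → ℝ → Set
x <ᴿ y = ∃ λ ε → 0ℚ < ε ×
  ∃ λ N → ∀ n → N ℕ.≤ n → seq x n + ε < seq y n

private
  halve : ∀ ε → 0ℚ < ε → ∃ λ h → 0ℚ < h × h + h ≡ ε
  halve ε 0<ε = ½ * ε
    , subst (_< ½ * ε) (ℚ.*-zeroʳ ½) (ℚ.*-monoʳ-<-pos ½ 0<ε)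
    , trans (sym (ℚ.*-distribʳ-+ ε ½ ½)) (ℚ.*-identityˡ ε)

  open GroupProperties ℚ.+-0-group
    using () renaming (//-rightDividesˡ to [p-q]+q; //-rightDividesʳ to [p+q]-q)
  open AbelianGroupProperties ℚ.+-0-abelianGroup
    using () renaming (⁻¹-anti-homo‿- to -[p-q])
  open CommutativeSemigroupProperties
    (CommutativeMonoid.commutativeSemigroup ℚ.+-0-commutativeMonoid)
    using (interchange)

  swap-+- : ∀ a b c d → (a + b) - (c + d) ≡ (a - c) + (b - d)
  swap-+- a b c d = trans (cong ((a + b) +_) (ℚ.neg-distrib-+ c d))
    (interchange a b (- c) (- d))

  swap-neg : ∀ a b → (- a) - (- b) ≡ - (a - b)
  swap-neg a b = sym (ℚ.neg-distrib-+ a (- b))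

  telescope : ∀ p q r → p - r ≡ (p - q) + (q - r)
  telescope p q r = trans (cong (_- r) (sym ([p-q]+q q p)))
    (ℚ.+-assoc (p - q) q (- r))

  split-* : ∀ a b c d → a * b - c * d ≡ a * (b - d) + d * (a - c)
  split-* a b c d = trans (telescope (a * b) (a * d) (c * d))
    (cong₂ _+_ (sym (distrib a b d))
      (trans (cong₂ _-_ (ℚ.*-comm a d) (ℚ.*-comm c d)) (sym (distrib d a c))))
    where
    distrib : ∀ p q r → p * (q - r) ≡ p * q - p * r
    distrib p q r = trans (ℚ.*-distribˡ-+ p q (- r))
      (cong (p * q +_) (sym (ℚ.neg-distribʳ-* p r)))

  ∣p∣≤∣p-q∣+∣q∣ : ∀ p q → ∣ p ∣ ≤ ∣ p - q ∣ + ∣ q ∣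
  ∣p∣≤∣p-q∣+∣q∣ p q =
    subst (λ r → ∣ r ∣ ≤ ∣ p - q ∣ + ∣ q ∣) ([p-q]+q q p) (ℚ.∣p+q∣≤∣p∣+∣q∣ (p - q) q)

  ∣p∣-∣q∣≤∣p-q∣ : ∀ p q → ∣ p ∣ - ∣ q ∣ ≤ ∣ p - q ∣
  ∣p∣-∣q∣≤∣p-q∣ p q = subst (∣ p ∣ - ∣ q ∣ ≤_) ([p+q]-q ∣ q ∣ ∣ p - q ∣)
    (ℚ.+-monoˡ-≤ (- ∣ q ∣) (∣p∣≤∣p-q∣+∣q∣ p q))

  ∣∣p∣-∣q∣∣≤∣p-q∣ : ∀ p q → ∣ ∣ p ∣ - ∣ q ∣ ∣ ≤ ∣ p - q ∣
  ∣∣p∣-∣q∣∣≤∣p-q∣ p q with ℚ.∣p∣≡p∨∣p∣≡-p (∣ p ∣ - ∣ q ∣)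
  ... | inj₁ eq = subst (_≤ ∣ p - q ∣) (sym eq) (∣p∣-∣q∣≤∣p-q∣ p q)
  ... | inj₂ eq = subst (_≤ ∣ p - q ∣) (sym (trans eq (-[p-q] ∣ p ∣ ∣ q ∣)))
    (subst (∣ q ∣ - ∣ p ∣ ≤_)
      (trans (cong ∣_∣ (sym (-[p-q] p q))) (ℚ.∣-p∣≡∣p∣ (p - q)))
      (∣p∣-∣q∣≤∣p-q∣ q p))

  bounded : ∀ u → Cauchy u →
    ∃ λ K → 0ℚ < K × ∃ λ N → ∀ n → N ℕ.≤ n → ∣ u n ∣ < K
  bounded u cu with cu 1ℚ (ℚ.positive⁻¹ 1ℚ)
  ... | N , close = 1ℚ + ∣ u N ∣
      , ℚ.<-≤-trans (ℚ.positive⁻¹ 1ℚ)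
          (subst (_≤ 1ℚ + ∣ u N ∣) (ℚ.+-identityʳ 1ℚ)
            (ℚ.+-monoʳ-≤ 1ℚ (ℚ.0≤∣p∣ (u N))))
      , N
      , λ n N≤n → ℚ.≤-<-trans (∣p∣≤∣p-q∣+∣q∣ (u n) (u N))
          (ℚ.+-monoˡ-< ∣ u N ∣ (close n N N≤n ℕ.≤-refl))

  quotient : ∀ K ε → 0ℚ < K → 0ℚ < ε → ∃ λ δ → 0ℚ < δ × K * δ ≡ ε
  quotient K ε 0<K 0<ε = 1/ K * ε , pos , eq
    where
    instance
      K-pos : Positive K
      K-pos = ℚ.positive 0<K
      K≢0 : ℚ.NonZero K
      K≢0 = ℚ.pos⇒nonZero K
      1/K-pos : Positive (1/ K)
      1/K-pos = ℚ.1/pos⇒pos K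
    pos : 0ℚ < 1/ K * ε
    pos = subst (_< 1/ K * ε) (ℚ.*-zeroʳ (1/ K)) (ℚ.*-monoʳ-<-pos (1/ K) 0<ε)
    eq : K * (1/ K * ε) ≡ ε
    eq = trans (sym (ℚ.*-assoc K (1/ K) ε))
      (trans (cong (_* ε) (ℚ.*-inverseʳ K)) (ℚ.*-identityˡ ε))

  +-bound : ∀ p q h ε → h + h ≡ ε → ∣ p ∣ < h → ∣ q ∣ < h → ∣ p + q ∣ < ε
  +-bound p q h ε h+h≡ε p<h q<h = ℚ.≤-<-trans (ℚ.∣p+q∣≤∣p∣+∣q∣ p q)
    (subst (∣ p ∣ + ∣ q ∣ <_) h+h≡ε (ℚ.+-mono-< p<h q<h))

  *-bound : ∀ a b K δ ε → 0ℚ < K → K * δ ≡ ε →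
    ∣ a ∣ < K → ∣ b ∣ < δ → ∣ a * b ∣ < ε
  *-bound a b K δ ε 0<K Kδ≡ε a<K b<δ =
    subst (∣ a * b ∣ <_) Kδ≡ε
      (subst (_< K * δ) (sym (ℚ.∣p*q∣≡∣p∣*∣q∣ a b))
        (ℚ.≤-<-trans
          (ℚ.*-monoʳ-≤-nonNeg ∣ b ∣ {{ℚ.∣-∣-nonNeg b}} (ℚ.<⇒≤ a<K))
          (ℚ.*-monoʳ-<-pos K {{ℚ.positive 0<K}} b<δ)))

  constant-cauchy : ∀ q → Cauchy (λ _ → q)
  constant-cauchy q ε 0<ε = 0 , λ _ _ _ _ →
    subst (λ r → ∣ r ∣ < ε) (sym (ℚ.+-inverseʳ q)) 0<ε

  +-cauchy : ∀ u v → Cauchy u → Cauchy v → Cauchy (λ n → u n + v n)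
  +-cauchy u v cu cv ε 0<ε =
    let h , 0<h , h+h≡ε = halve ε 0<ε
        M , u-close     = cu h 0<h
        N , v-close     = cv h 0<h
    in M ℕ.⊔ N , λ m n m≥ n≥ →
      subst (λ r → ∣ r ∣ < ε) (sym (swap-+- (u m) (v m) (u n) (v n)))
        (+-bound (u m - u n) (v m - v n) h ε h+h≡ε
          (u-close m n (ℕ.m⊔n≤o⇒m≤o M N m≥) (ℕ.m⊔n≤o⇒m≤o M N n≥))
          (v-close m n (ℕ.m⊔n≤o⇒n≤o M N m≥) (ℕ.m⊔n≤o⇒n≤o M N n≥)))

  neg-cauchy : ∀ u → Cauchy u → Cauchy (λ n → - u n)
  neg-cauchy u cu ε 0<ε with cu ε 0<ε
  ... | N , close = N , λ m n m≥ n≥ →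
    subst (_< ε)
      (sym (trans (cong ∣_∣ (swap-neg (u m) (u n))) (ℚ.∣-p∣≡∣p∣ (u m - u n))))
      (close m n m≥ n≥)

  abs-cauchy : ∀ u → Cauchy u → Cauchy (λ n → ∣ u n ∣)
  abs-cauchy u cu ε 0<ε with cu ε 0<ε
  ... | N , close = N , λ m n m≥ n≥ →
    ℚ.≤-<-trans (∣∣p∣-∣q∣∣≤∣p-q∣ (u m) (u n)) (close m n m≥ n≥)

  *-close : ∀ (u v : ℕ → ℚ) ε h K L δ η → 0ℚ < K → 0ℚ < L →
    h + h ≡ ε → K * δ ≡ h → L * η ≡ h → ∀ m n →
    ∣ u m ∣ < K → ∣ v n ∣ < L → ∣ v m - v n ∣ < δ → ∣ u m - u n ∣ < η →
    ∣ u m * v m - u n * v n ∣ < ε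
  *-close u v ε h K L δ η 0<K 0<L h+h≡ Kδ≡ Lη≡ m n u<K v<L v-close u-close =
    subst (λ r → ∣ r ∣ < ε) (sym (split-* (u m) (v m) (u n) (v n)))
      (+-bound (u m * (v m - v n)) (v n * (u m - u n)) h ε h+h≡
        (*-bound (u m) (v m - v n) K δ h 0<K Kδ≡ u<K v-close)
        (*-bound (v n) (u m - u n) L η h 0<L Lη≡ v<L u-close))

  *-cauchy : ∀ u v → Cauchy u → Cauchy v → Cauchy (λ n → u n * v n)
  *-cauchy u v cu cv ε 0<ε =
    let h , 0<h , h+h≡     = halve ε 0<ε
        K , 0<K , N₁ , u<K = bounded u cu
        L , 0<L , N₂ , v<L = bounded v cv
        δ , 0<δ , Kδ≡      = quotient K h 0<K 0<h
        η , 0<η , Lη≡      = quotient L h 0<L 0<h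
        N₃ , v-close       = cv δ 0<δ
        N₄ , u-close       = cu η 0<η
        N₁₂ = N₁ ℕ.⊔ N₂
        N₃₄ = N₃ ℕ.⊔ N₄
    in N₁₂ ℕ.⊔ N₃₄ , λ m n m≥ n≥ →
      let m≥₁₂ = ℕ.m⊔n≤o⇒m≤o N₁₂ N₃₄ m≥
          m≥₃₄ = ℕ.m⊔n≤o⇒n≤o N₁₂ N₃₄ m≥
          n≥₁₂ = ℕ.m⊔n≤o⇒m≤o N₁₂ N₃₄ n≥
          n≥₃₄ = ℕ.m⊔n≤o⇒n≤o N₁₂ N₃₄ n≥
      in *-close u v ε h K L δ η 0<K 0<L h+h≡ Kδ≡ Lη≡ m n
           (u<K m (ℕ.m⊔n≤o⇒m≤o N₁ N₂ m≥₁₂))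
           (v<L n (ℕ.m⊔n≤o⇒n≤o N₁ N₂ n≥₁₂))
           (v-close m n (ℕ.m⊔n≤o⇒m≤o N₃ N₄ m≥₃₄) (ℕ.m⊔n≤o⇒m≤o N₃ N₄ n≥₃₄))
           (u-close m n (ℕ.m⊔n≤o⇒n≤o N₃ N₄ m≥₃₄) (ℕ.m⊔n≤o⇒n≤o N₃ N₄ n≥₃₄))

fromℚ : ℚ → ℝ
fromℚ q = mkℝ (λ _ → q) (constant-cauchy q)

0ᴿ 1ᴿ : ℝ
0ᴿ = fromℚ 0ℚ
1ᴿ = fromℚ 1ℚ

infixl 6 _+ᴿ_ _-ᴿ_
infixl 7 _*ᴿ_
infix  8 -ᴿ_

_+ᴿ_ _*ᴿ_ : ℝ → ℝ → ℝ
x +ᴿ y = mkℝ (λ n → seq x n + seq y n) (+-cauchy (seq x) (seq y) (cauchy x) (cauchy y))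
x *ᴿ y = mkℝ (λ n → seq x n * seq y n) (*-cauchy (seq x) (seq y) (cauchy x) (cauchy y))

-ᴿ_ ∣_∣ᴿ : ℝ → ℝ
-ᴿ x   = mkℝ (λ n → - seq x n) (neg-cauchy (seq x) (cauchy x))
∣ x ∣ᴿ = mkℝ (λ n → ∣ seq x n ∣) (abs-cauchy (seq x) (cauchy x))

_-ᴿ_ : ℝ → ℝ → ℝ
x -ᴿ y = x +ᴿ (-ᴿ y)

product : List ℝ → ℝ
product = foldr _*ᴿ_ 1ᴿ

_⟶_ : (ℕ → ℝ) → ℝ → Set
u ⟶ x = ∀ ε → 0ᴿ <ᴿ ε → ∃ λ N → ∀ n → N ℕ.≤ n → ∣ u n -ᴿ x ∣ᴿ <ᴿ ε

-- Subsets of ℝ are predicates X with X Respects _≈ᴿ_.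
⟨0,1⟩ : Pred ℝ 0ℓ
⟨0,1⟩ x = 0ᴿ <ᴿ x × x <ᴿ 1ᴿ

｛0,1｝ : Pred ℝ 0ℓ
｛0,1｝ x = x ≈ᴿ 0ᴿ ⊎ x ≈ᴿ 1ᴿ

infix 9 _′

_′ : Pred ℝ 0ℓ → Pred ℝ 0ℓ
(X ′) x = ∀ ε → 0ᴿ <ᴿ ε → ∃ λ y → y ∈ X × ¬ (y ≈ᴿ x) × ∣ y -ᴿ x ∣ᴿ <ᴿ ε

------------------------------------------------------------------------
-- Subsets of ω and families of them

-- 𝒫(ω), as characteristic functions.  Under excluded middle this is the
-- full power set; equality of subsets is pointwise.
𝒫ω : Setoid 0ℓ 0ℓ
𝒫ω = ℕ →-setoid Bool

Subset : Set
Subset = Setoid.Carrier 𝒫ω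

Family : Set₁
Family = Pred Subset 0ℓ

∅ ω : Subset
∅ _ = false
ω _ = true

∁ : Subset → Subset
∁ A n = not (A n)

infixr 7 _∩_
infixr 6 _∪_

_∩_ _∪_ : Subset → Subset → Subset
(A ∩ B) n = A n ∧ B n
(A ∪ B) n = A n ∨ B n

⋂ : List Subset → Subset
⋂ = foldr _∩_ ω

data ⟨_⟩ (𝒜 : Family) : Family where
  generator  : ∀ {A} → A ∈ 𝒜 → A ∈ ⟨ 𝒜 ⟩
  empty      : ∅ ∈ ⟨ 𝒜 ⟩
  complement : ∀ {A} → A ∈ ⟨ 𝒜 ⟩ → ∁ A ∈ ⟨ 𝒜 ⟩
  union      : ∀ {A B} → A ∈ ⟨ 𝒜 ⟩ → B ∈ ⟨ 𝒜 ⟩ → A ∪ B ∈ ⟨ 𝒜 ⟩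

-- The members of 𝒜 up to equality of subsets, so that cardinalities do
-- not count different proofs of membership.
Members : Family → Setoid 0ℓ 0ℓ
Members 𝒜 = On.setoid {B = Σ Subset 𝒜} 𝒫ω proj₁

AtMostCountable : Family → Set
AtMostCountable 𝒜 = Injection (Members 𝒜) (setoid ℕ)

-- 𝔠 = 2^ℵ₀
HasCardinality𝔠 : Family → Set
HasCardinality𝔠 𝒜 = Bijection (ℕ →-setoid Bool) (Members 𝒜)

------------------------------------------------------------------------
-- Asymptotic density

-- countBelow A n = |A ∩ n|, where n = {0, …, n-1}.
countBelow : Subset → ℕ → ℕ
countBelow A zero    = 0
countBelow A (suc n) = (if A n then 1 else 0) ℕ.+ countBelow A n

-- The sequence is indexed from n = 1, where the quotient is defined.
HasDensity : Subset → ℝ → Set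
HasDensity A x = (λ n → fromℚ ((ℤ.+ countBelow A (suc n)) ℚ./ suc n)) ⟶ x

𝒟 : Family
𝒟 A = ∃ λ x → HasDensity A x

d[_] : Family → Pred ℝ 0ℓ
d[ ℱ ] x = ∃ λ A → A ∈ ℱ × HasDensity A x

Unique : List Subset → Set
Unique = UniqueSetoid.Unique 𝒫ω

-- The finite nonempty subfamilies are listed without repetition as A ∷ F.
Independent : Family → Set
Independent 𝒜 = ∀ A F → Unique (A ∷ F) → All 𝒜 (A ∷ F) →
  ∀ xs → Pointwise HasDensity (A ∷ F) xs →
  HasDensity (⋂ (A ∷ F)) (product xs)

IsDIndependent : Family → Set
IsDIndependent 𝒜 =
  Satisfiable 𝒜 × 𝒜 ⊆ 𝒟 ×
  d[ 𝒜 ] ⊆ ⟨0,1⟩ ×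
  ⟨ 𝒜 ⟩ ⊆ 𝒟 ×
  Independent 𝒜

IsMaximalDIndependent : Family → Set₁
IsMaximalDIndependent 𝒜 =
  IsDIndependent 𝒜 × (∀ ℬ → IsDIndependent ℬ → 𝒜 ⊆ ℬ → ℬ ⊆ 𝒜)

{-# OPTIONS --safe #-}
-- Starting from a d-independent family of size 𝔠 whose densities are exactly the
-- elements of S, take 𝒜₁ maximal among the d-independent extensions with
-- densities in S, then 𝒜 ⊇ 𝒜₁ maximal among all d-independent families, and put
-- ℬ = 𝒜 ∖ 𝒜₁.  If ℬ had infinitely many members Xₙ with densities in [δ, 1-δ],
-- then, reading n ↦ Xₙ(m) as a binary expansion of m, the set Y of all m below a
-- suitable threshold would have a prescribed density s₀ ∈ S and be independent
-- of 𝒜₁, because it is sandwiched between finite boolean combinations of the Xₙ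
-- whose densities differ arbitrarily little; this contradicts the maximality of
-- 𝒜₁.  So each such class is finite, ℬ is countable, and its densities
-- accumulate only at 0 and 1.
--
-- The initial family comes from the Walsh sets {n : the digits of n at the
-- positions in M have odd sum}.  For M ranging over the branches of a binary
-- tree they are independent of density ½, since flipping a digit that lies on
-- only one of finitely many branches complements one of the sets and fixes the
-- others.  Splitting them into 𝔠 many sequences and thresholding each sequence
-- yields independent sets with any prescribed densities.
--
-- Excluded middle for arbitrary types decides them with a witness, so it also
-- serves as the axiom of choice.
module Submission where

open import Axiom.ExcludedMiddle using (ExcludedMiddle)
open import Axiom.Extensionality.Propositional using (Extensionality)
open import Data.Bool.Base using (Bool; true; false; not; _∧_; _∨_; _xor_; if_then_else_)
import Data.Bool.Properties as Bool
open import Data.Empty using (⊥; ⊥-elim)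
open import Data.Fin.Base using (toℕ)
import Data.Integer.Base as ℤ
import Data.Integer.Properties as ℤ
open import Data.List.Base using (List; []; _∷_; foldr; _++_)
open import Data.List.Membership.Propositional using () renaming (_∈_ to _∈ˡ_; _∉_ to _∉ˡ_)
open import Data.List.Relation.Binary.Permutation.Propositional as Perm
  using (_↭_; prep; swap; ↭-refl; ↭-trans)
open import Data.List.Relation.Binary.Permutation.Propositional.Properties using (All-resp-↭)
open import Data.List.Relation.Binary.Pointwise using (Pointwise; []; _∷_)
open import Data.List.Relation.Unary.All as All using (All; []; _∷_)
import Data.List.Relation.Unary.All.Properties as All
open import Data.List.Relation.Unary.AllPairs as AllPairs using ([]; _∷_)
open import Data.List.Relation.Unary.Any using (here; there; index)
open import Data.List.Relation.Unary.Unique.Propositional using () renaming (Unique to Distinct)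
open import Data.Nat.Base as ℕ using (ℕ; zero; suc)
open import Data.Nat.Binary.Base as ℕᵇ using (ℕᵇ; zero; 2[1+_]; 1+[2_]; fromℕ)
open import Data.Nat.Binary.Properties using (fromℕ-toℕ; toℕ-fromℕ)
import Data.Nat.Properties as ℕ
open import Data.Product.Base using (Σ; ∃; ∃₂; _×_; _,_; proj₁; proj₂)
open import Data.Rational.Base as ℚ
  using (ℚ; 0ℚ; 1ℚ; ½; _+_; _-_; -_; _*_; ∣_∣; _≤_; _<_; _⊓_;
    Positive; positive; nonNegative; mkℚ; toℚᵘ; 1/_)
import Data.Rational.Properties as ℚ
import Data.Rational.Unnormalised.Base as ℚᵘ
import Data.Rational.Unnormalised.Properties as ℚᵘ
open import Data.Sum.Base as Sum using (_⊎_; inj₁; inj₂; [_,_]′)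
open import Function.Base using (_∘_; const; id)
open import Level using (0ℓ)
open import Relation.Binary.Definitions using (_Respects_)
open import Relation.Binary.PropositionalEquality
  using (_≡_; _≢_; refl; sym; trans; cong; cong₂; subst; subst₂)
open import Relation.Nullary.Decidable using (decidable-stable)
open import Relation.Nullary.Decidable.Core using (Dec; yes; no; ⌊_⌋; toSum; dec⇒maybe)
open import Relation.Nullary.Negation.Core using (¬_)
open import Relation.Unary using (Pred; _∈_; _∉_; _⊆_; _≐_; _∖_; Satisfiable)
open import Tactic.RingSolver using (solve-∀)
open import Tactic.RingSolver.Core.AlmostCommutativeRing
  using (AlmostCommutativeRing; fromCommutativeRing)
open import Defs

-- Classical logic

module Logic (em : ExcludedMiddle 0ℓ) where

  test : Set → Bool
  test A = ⌊ em {A} ⌋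

  test⁺ : ∀ {A} → A → test A ≡ true
  test⁺ {A} a with em {A}
  ... | yes _ = refl
  ... | no ¬a = ⊥-elim (¬a a)

  test⁻ : ∀ {A} → test A ≡ true → A
  test⁻ {A} _ with em {A}
  test⁻ _  | yes a = a
  test⁻ () | no _

  decide : ∀ (A : Set) → A ⊎ ¬ A
  decide A = toSum em

  dne : {A : Set} → ¬ ¬ A → A
  dne = decidable-stable em

  ¬∀⇒∃¬ : {A : Set} {B : A → Set} → ¬ (∀ a → B a) → ∃ λ a → ¬ B a
  ¬∀⇒∃¬ ¬∀ = dne λ ¬∃ → ¬∀ λ a → dne λ ¬b → ¬∃ (a , ¬b)

-- Tukey's lemma

infixl 6 _▹_

_▹_ : {X : Set} → Pred X 0ℓ → X → Pred X 0ℓ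
(𝒜 ▹ y) x = x ∈ 𝒜 ⊎ x ≡ y

module Tukey (em : ExcludedMiddle 0ℓ) (ext : Extensionality 0ℓ 0ℓ)
  {X : Set} (Good : List X → Set) (Base : Pred X 0ℓ)
  where

  open Logic em

  AllGood : Pred X 0ℓ → Set
  AllGood 𝒜 = ∀ F → All 𝒜 F → Good F

  private
    -- Bool-valued predicates form a small type, over which excluded middle
    -- is available.
    Sub : Set
    Sub = X → Bool

    T : Sub → Pred X 0ℓ
    T F x = F x ≡ true

    _⊑_ : Sub → Sub → Set
    F ⊑ G = ∀ x → T F x → T G x

    ⊑-antisym : ∀ {F G} → F ⊑ G → G ⊑ F → F ≡ G
    ⊑-antisym {F} {G} p q = ext λ x → eq x (F x) (G x) refl refl
      where
      eq : ∀ x a b → F x ≡ a → G x ≡ b → F x ≡ G x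
      eq x true  b     f g = trans f (sym (p x f))
      eq x false true  f g = trans (q x g) (sym g)
      eq x false false f g = trans f (sym g)

    Extra : Sub → Set
    Extra F = ∃ λ y → ¬ T F y × AllGood (T F ▹ y)

    -- The witness inside the decision acts as a choice function for one-point extensions. Taking
    -- the decision as an argument lets properties of `next` be proved by cases on it.
    next′ : (F : Sub) → Dec (Extra F) → Sub
    next′ F (yes (y , _)) x = test ((T F ▹ y) x)
    next′ F (no _)          = F

    next : Sub → Sub
    next F = next′ F em

    ⊑next : ∀ {F} → F ⊑ next F
    ⊑next {F} = go em
      where
      go : ∀ d → F ⊑ next′ F d
      go (yes _) x h = test⁺ (inj₁ h)
      go (no _)  x h = h

    -- next adds at most one element, so nothing fits strictly between.
    next-cover : ∀ {F G} → F ⊑ G → G ⊑ next F → G ⊑ F ⊎ next F ⊑ G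
    next-cover {F} {G} = go em
      where
      go : ∀ d → F ⊑ G → G ⊑ next′ F d → G ⊑ F ⊎ next′ F d ⊑ G
      go (no _) F⊑G G⊑ = inj₁ G⊑
      go (yes (y , _)) F⊑G G⊑ with decide (T G y)
      ... | inj₁ Gy = inj₂ λ x h → [ F⊑G x , (λ { refl → Gy }) ]′ (test⁻ h)
      ... | inj₂ ¬Gy = inj₁ λ x Gx →
        [ (λ Fx → Fx) , (λ { refl → ⊥-elim (¬Gy Gx) }) ]′ (test⁻ (G⊑ x Gx))

    -- Every union contains `Base`, so the empty union is the least stage of the tower.
    ⋃ : (Sub → Bool) → Sub
    ⋃ 𝒞 x = test (Base x ⊎ ∃ λ F → 𝒞 F ≡ true × T F x)

    -- Takes the place of a transfinite iteration of `next` starting from `Base`.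
    data Tower : Sub → Set where
      step : ∀ {F} → Tower F → Tower (next F)
      sup  : ∀ 𝒞 → (∀ F → 𝒞 F ≡ true → Tower F) → Tower (⋃ 𝒞)

    base⊑ : ∀ {F} → Tower F → Base ⊆ T F
    base⊑ (step t)  b = ⊑next _ (base⊑ t b)
    base⊑ (sup _ _) b = test⁺ (inj₁ b)

    ∈⋃ : ∀ {𝒞 F} → 𝒞 F ≡ true → F ⊑ ⋃ 𝒞
    ∈⋃ c x h = test⁺ (inj₂ (_ , c , h))

    ⋃⊑ : ∀ {𝒞 G} → Base ⊆ T G → (∀ F → 𝒞 F ≡ true → F ⊑ G) → ⋃ 𝒞 ⊑ G
    ⋃⊑ b h x x∈ = [ b , (λ { (F , c , Fx) → h F c x Fx }) ]′ (test⁻ x∈)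

    all⊎some : ∀ {A B : Sub → Set} (𝒞 : Sub → Bool) →
      (∀ F → 𝒞 F ≡ true → A F ⊎ B F) →
      (∀ F → 𝒞 F ≡ true → A F) ⊎ ∃ λ F → 𝒞 F ≡ true × B F
    all⊎some {A} {B} 𝒞 h with decide (∃ λ F → 𝒞 F ≡ true × B F)
    ... | inj₁ p = inj₂ p
    ... | inj₂ ¬p = inj₁ λ F c → [ (λ a → a) , (λ b → ⊥-elim (¬p (F , c , b))) ]′ (h F c)

    Comparable : Sub → Set
    Comparable C = ∀ D → Tower D → D ⊑ C ⊎ C ⊑ D

    -- Induction on the tower of `D`. In the successor case with `D ⊑ C ⊑ next D` nothing fits
    -- strictly between, so either `next D ⊑ C` or `C` equals `D`.
    comparable-next : ∀ {C} → Tower C → Comparable C → ∀ {D} → Tower D → D ⊑ C ⊎ next C ⊑ D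
    comparable-next {C} tc cmp (sup 𝒞 ts)
      with all⊎some 𝒞 (λ F c → comparable-next tc cmp (ts F c))
    ... | inj₁ all           = inj₁ (⋃⊑ (base⊑ tc) all)
    ... | inj₂ (F , c , C⊑F) = inj₂ λ x h → ∈⋃ c x (C⊑F x h)
    comparable-next {C} tc cmp (step {D} td) with comparable-next tc cmp td
    ... | inj₂ C⊑D = inj₂ λ x h → ⊑next x (C⊑D x h)
    ... | inj₁ D⊑C with cmp (next D) (step td)
    ...   | inj₁ p = inj₁ p
    ...   | inj₂ C⊑nD with next-cover D⊑C C⊑nD
    ...     | inj₂ nD⊑C = inj₁ nD⊑C
    ...     | inj₁ C⊑D = inj₂ (subst (λ F → next F ⊑ next D) (⊑-antisym D⊑C C⊑D) (λ _ h → h))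

    -- Induction on the tower of `C`: successors are handled by `comparable-next`; for a union,
    -- either every member lies below `D` or some member lies above it.
    comparable : ∀ {C} → Tower C → Comparable C
    comparable (step t) D td with comparable-next t (comparable t) td
    ... | inj₁ D⊑C = inj₁ λ x h → ⊑next x (D⊑C x h)
    ... | inj₂ C⊑D = inj₂ C⊑D
    comparable (sup 𝒞 ts) D td
      with all⊎some 𝒞 (λ F c → Sum.swap (comparable (ts F c) D td))
    ... | inj₁ all           = inj₂ (⋃⊑ (base⊑ td) all)
    ... | inj₂ (F , c , D⊑F) = inj₁ λ x h → ∈⋃ c x (D⊑F x h)

    module _ (base-good : AllGood Base) where

      -- The tower is a chain, so the largest of finitely many members contains the whole list.
      -- Lists within `Base` are treated apart because `𝒞` may be empty.
      within-one : ∀ 𝒞 → (∀ F → 𝒞 F ≡ true → Tower F) → ∀ xs → All (T (⋃ 𝒞)) xs →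
        All Base xs ⊎ ∃ λ F → 𝒞 F ≡ true × All (T F) xs
      within-one 𝒞 ts [] [] = inj₁ []
      within-one 𝒞 ts (x ∷ xs) (p ∷ ps) with test⁻ p | within-one 𝒞 ts xs ps
      ... | inj₁ b           | inj₁ bs            = inj₁ (b ∷ bs)
      ... | inj₁ b           | inj₂ (F , c , fs)  = inj₂ (F , c , base⊑ (ts F c) b ∷ fs)
      ... | inj₂ (F , c , f) | inj₁ bs            = inj₂ (F , c , f ∷ All.map (base⊑ (ts F c)) bs)
      ... | inj₂ (F , c , f) | inj₂ (G , d , gs) with comparable (ts F c) G (ts G d)
      ...   | inj₁ G⊑F = inj₂ (F , c , f ∷ All.map (G⊑F _) gs)
      ...   | inj₂ F⊑G = inj₂ (G , d , F⊑G _ f ∷ gs)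

      tower-good : ∀ {F} → Tower F → AllGood (T F)
      tower-good (step {F} t) = go em
        where
        go : ∀ d → AllGood (T (next′ F d))
        go (yes (y , _ , good)) xs ps = good xs (All.map test⁻ ps)
        go (no _) = tower-good t
      tower-good (sup 𝒞 ts) xs ps with within-one 𝒞 ts xs ps
      ... | inj₁ bs           = base-good xs bs
      ... | inj₂ (F , c , fs) = tower-good (ts F c) xs fs

  -- The union of the whole tower belongs to the tower and therefore contains its own `next`. If
  -- some element could still be added, `next` would have added one from outside, a contradiction.
  tukey : AllGood Base → ∃ λ (𝒜 : X → Bool) →
    (∀ {x} → Base x → 𝒜 x ≡ true) ×
    AllGood (λ x → 𝒜 x ≡ true) ×
    (∀ y → AllGood ((λ x → 𝒜 x ≡ true) ▹ y) → 𝒜 y ≡ true)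
  tukey base-good = top , base⊑ top-tower , tower-good base-good top-tower , maximal
    where
    everything : Sub → Bool
    everything F = test (Tower F)
    top : Sub
    top = ⋃ everything
    top-tower : Tower top
    top-tower = sup everything λ F → test⁻
    next⊑top : next top ⊑ top
    next⊑top = ∈⋃ {everything} (test⁺ (step top-tower))
    maximal : ∀ y → AllGood (T top ▹ y) → T top y
    maximal y good = dne λ ¬top → go ¬top em next⊑top
      where
      go : ¬ T top y → ∀ d → next′ top d ⊑ top → ⊥
      go ¬top (yes (z , ¬z , _)) h = ¬z (h z (test⁺ (inj₂ refl)))
      go ¬top (no ¬extra)        h = ¬extra (y , ¬top , good)

-- Sequences of rationals modulo null sequences

ℚ-ring : AlmostCommutativeRing 0ℓ 0ℓ
ℚ-ring = fromCommutativeRing ℚ.+-*-commutativeRing λ p → dec⇒maybe (0ℚ ℚ.≟ p)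

0<⇒< : ∀ {p q} → 0ℚ < q - p → p < q
0<⇒< {p} {q} 0<q-p = subst₂ _<_ (ℚ.+-identityˡ p) (eq p q) (ℚ.+-monoˡ-< p 0<q-p)
  where
  eq : ∀ p q → (q - p) + p ≡ q
  eq = solve-∀ ℚ-ring

0≤⇒≤ : ∀ {p q} → 0ℚ ≤ q - p → p ≤ q
0≤⇒≤ {p} {q} 0≤q-p = subst₂ _≤_ (ℚ.+-identityˡ p) (eq p q) (ℚ.+-monoˡ-≤ p 0≤q-p)
  where
  eq : ∀ p q → (q - p) + p ≡ q
  eq = solve-∀ ℚ-ring

-- Linear inequalities are proved by exhibiting the gap of the conclusion as
-- the gap of a sum of hypotheses, a ring identity.
<-by : ∀ {a b c d} → a < b → b - a ≡ d - c → c < d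
<-by {a} {b} a<b eq = 0<⇒< (subst (0ℚ <_) eq
  (subst (_< b - a) (ℚ.+-inverseʳ a) (ℚ.+-monoˡ-< (- a) a<b)))

≤-by : ∀ {a b c d} → a ≤ b → b - a ≡ d - c → c ≤ d
≤-by {a} {b} a≤b eq = 0≤⇒≤ (subst (0ℚ ≤_) eq
  (subst (_≤ b - a) (ℚ.+-inverseʳ a) (ℚ.+-monoˡ-≤ (- a) a≤b)))

0<½* : ∀ {ε} → 0ℚ < ε → 0ℚ < ½ * ε
0<½* {ε} 0<ε = subst (_< ½ * ε) (ℚ.*-zeroʳ ½) (ℚ.*-monoʳ-<-pos ½ 0<ε)

½*+½* : ∀ ε → ½ * ε + ½ * ε ≡ ε
½*+½* = solve-∀ ℚ-ring

0<* : ∀ {p q} → 0ℚ < p → 0ℚ < q → 0ℚ < p * q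
0<* {p} {q} 0<p 0<q = subst (_< p * q) (ℚ.*-zeroʳ p) (ℚ.*-monoʳ-<-pos p {{positive 0<p}} 0<q)

*-monoˡ : ∀ {p q} r → 0ℚ ≤ r → p ≤ q → p * r ≤ q * r
*-monoˡ r 0≤r = ℚ.*-monoʳ-≤-nonNeg r {{nonNegative 0≤r}}

0≤* : ∀ {p q} → 0ℚ ≤ p → 0ℚ ≤ q → 0ℚ ≤ p * q
0≤* {p} {q} 0≤p 0≤q = subst (_≤ p * q) (ℚ.*-zeroˡ q) (*-monoˡ q 0≤q 0≤p)

0<⊓ : ∀ {p q} → 0ℚ < p → 0ℚ < q → 0ℚ < p ⊓ q
0<⊓ {p} {q} 0<p 0<q with ℚ.⊓-sel p q
... | inj₁ e = subst (0ℚ <_) (sym e) 0<p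
... | inj₂ e = subst (0ℚ <_) (sym e) 0<q

0<1 : 0ℚ < 1ℚ
0<1 = ℚ.positive⁻¹ 1ℚ

∣-∣<⇒ˡ : ∀ p q {ε} → ∣ p - q ∣ < ε → p < q + ε
∣-∣<⇒ˡ p q {ε} h = <-by (ℚ.≤-<-trans (≤∣∣ (p - q)) h) (eq p q ε)
  where
  ≤∣∣ : ∀ r → r ≤ ∣ r ∣
  ≤∣∣ r with ℚ.≤-total 0ℚ r
  ... | inj₁ 0≤r = ℚ.≤-reflexive (sym (ℚ.0≤p⇒∣p∣≡p 0≤r))
  ... | inj₂ r≤0 = ℚ.≤-trans r≤0 (ℚ.0≤∣p∣ r)
  eq : ∀ p q ε → ε - (p - q) ≡ (q + ε) - p
  eq = solve-∀ ℚ-ring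

∣-∣-sym : ∀ p q → ∣ p - q ∣ ≡ ∣ q - p ∣
∣-∣-sym p q = trans (cong ∣_∣ (eq p q)) (ℚ.∣-p∣≡∣p∣ (q - p))
  where
  eq : ∀ p q → p - q ≡ - (q - p)
  eq = solve-∀ ℚ-ring

∣-∣<⇒ʳ : ∀ p q {ε} → ∣ p - q ∣ < ε → q < p + ε
∣-∣<⇒ʳ p q h = ∣-∣<⇒ˡ q p (subst (_< _) (∣-∣-sym p q) h)

⇒∣-∣< : ∀ p q {ε} → p < q + ε → q < p + ε → ∣ p - q ∣ < ε
⇒∣-∣< p q {ε} p< q< with ℚ.∣p∣≡p∨∣p∣≡-p (p - q)
... | inj₁ eq = subst (_< ε) (sym eq) (<-by p< (eq₁ p q ε))
  where
  eq₁ : ∀ p q ε → (q + ε) - p ≡ ε - (p - q)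
  eq₁ = solve-∀ ℚ-ring
... | inj₂ eq = subst (_< ε) (sym eq) (<-by q< (eq₂ p q ε))
  where
  eq₂ : ∀ p q ε → (p + ε) - q ≡ ε - - (p - q)
  eq₂ = solve-∀ ℚ-ring

Ev : (ℕ → Set) → Set
Ev P = ∃ λ N → ∀ n → N ℕ.≤ n → P n

ev-map : ∀ {P Q} → (∀ n → P n → Q n) → Ev P → Ev Q
ev-map f (N , p) = N , λ n N≤n → f n (p n N≤n)

ev-map₂ : ∀ {P Q R} → (∀ n → P n → Q n → R n) → Ev P → Ev Q → Ev R
ev-map₂ f (M , p) (N , q) = M ℕ.⊔ N , λ n h →
  f n (p n (ℕ.m⊔n≤o⇒m≤o M N h)) (q n (ℕ.m⊔n≤o⇒n≤o M N h))

ev-all : {P : ℕ → Set} → (∀ n → P n) → Ev P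
ev-all p = 0 , λ n _ → p n

ev-witness : {P : ℕ → Set} → Ev P → ∃ P
ev-witness (N , p) = N , p N ℕ.≤-refl

Seq : Set
Seq = ℕ → ℚ

infixl 6 _⊕_ _⊖_
infixl 7 _⊛_

_⊕_ _⊖_ _⊛_ : Seq → Seq → Seq
(u ⊕ v) n = u n + v n
(u ⊖ v) n = u n - v n
(u ⊛ v) n = u n * v n

infix 4 _≾_ _≋_

-- The order and equality of the reals represented by Cauchy sequences, but
-- defined for all sequences: inequality and equality up to a null sequence.
record _≾_ (u v : Seq) : Set where
  constructor mk≾
  field
    within : ∀ ε → 0ℚ < ε → Ev λ n → u n < v n + ε

open _≾_ public

_≋_ : Seq → Seq → Set
u ≋ v = u ≾ v × v ≾ u

Unit : Seq → Set
Unit u = ∀ n → 0ℚ ≤ u n × u n ≤ 1ℚ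

≾-intro : ∀ {u v} → (∀ ε → 0ℚ < ε → Ev λ n → u n < v n + (ε + ε)) → u ≾ v
≾-intro {u} {v} h = mk≾ λ ε 0<ε →
  ev-map (λ n → subst (λ x → u n < v n + x) (½*+½* ε)) (h (½ * ε) (0<½* 0<ε))

≤⇒≾ : ∀ {u v} → (∀ n → u n ≤ v n) → u ≾ v
≤⇒≾ {u} {v} h = mk≾ λ ε 0<ε → ev-all λ n →
  subst (_< v n + ε) (ℚ.+-identityʳ (u n)) (ℚ.+-mono-≤-< (h n) 0<ε)

≾-refl : ∀ {u} → u ≾ u
≾-refl = ≤⇒≾ λ _ → ℚ.≤-refl

≾-trans : ∀ {u v w} → u ≾ v → v ≾ w → u ≾ w
≾-trans {u} {v} {w} p q = ≾-intro λ ε 0<ε →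
  ev-map₂ (λ n a b → <-by (ℚ.+-mono-< a b) (eq (u n) (v n) (w n) ε)) (within p ε 0<ε) (within q ε 0<ε)
  where
  eq : ∀ u v w ε → ((v + ε) + (w + ε)) - (u + v) ≡ (w + (ε + ε)) - u
  eq = solve-∀ ℚ-ring

≾-+ : ∀ {u v u′ v′} → u ≾ v → u′ ≾ v′ → u ⊕ u′ ≾ v ⊕ v′
≾-+ {u} {v} {u′} {v′} p q = ≾-intro λ ε 0<ε →
  ev-map₂ (λ n a b → <-by (ℚ.+-mono-< a b) (eq (u n) (v n) (u′ n) (v′ n) ε))
    (within p ε 0<ε) (within q ε 0<ε)
  where
  eq : ∀ u v u′ v′ ε → ((v + ε) + (v′ + ε)) - (u + u′) ≡ ((v + v′) + (ε + ε)) - (u + u′)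
  eq = solve-∀ ℚ-ring

≾-− : ∀ {u v u′ v′} → u ≾ v → v′ ≾ u′ → u ⊖ u′ ≾ v ⊖ v′
≾-− {u} {v} {u′} {v′} p q = ≾-intro λ ε 0<ε →
  ev-map₂ (λ n a b → <-by (ℚ.+-mono-< a b) (eq (u n) (v n) (u′ n) (v′ n) ε))
    (within p ε 0<ε) (within q ε 0<ε)
  where
  eq : ∀ u v u′ v′ ε → ((v + ε) + (u′ + ε)) - (u + v′) ≡ ((v - v′) + (ε + ε)) - (u - u′)
  eq = solve-∀ ℚ-ring

≾-* : ∀ {u v w} → Unit w → u ≾ v → u ⊛ w ≾ v ⊛ w
≾-* {u} {v} {w} 0≤w≤1 p = ≾-intro λ ε 0<ε → ev-map (λ n u<v+ε →
    let 0≤w , w≤1 = 0≤w≤1 n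
        -- As `w` is at most `1`, the error `ε` is not enlarged by the factor; the second `ε`
        -- restores strictness.
        uw≤ = *-monoˡ (w n) 0≤w (ℚ.<⇒≤ u<v+ε)
        wε≤ = *-monoˡ ε (ℚ.<⇒≤ 0<ε) w≤1
    in <-by (ℚ.+-mono-≤-< (ℚ.+-mono-≤ uw≤ wε≤) 0<ε) (eq (u n) (v n) (w n) ε))
  (within p ε 0<ε)
  where
  eq : ∀ u v w ε → ((v + ε) * w + 1ℚ * ε + ε) - (u * w + w * ε + 0ℚ) ≡ (v * w + (ε + ε)) - u * w
  eq = solve-∀ ℚ-ring

≾-*ˡ : ∀ {u v w} → Unit w → u ≾ v → w ⊛ u ≾ w ⊛ v
≾-*ˡ {u} {v} {w} 1w p = ≾-trans (≤⇒≾ λ n → ℚ.≤-reflexive (ℚ.*-comm (w n) (u n)))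
  (≾-trans (≾-* 1w p) (≤⇒≾ λ n → ℚ.≤-reflexive (ℚ.*-comm (v n) (w n))))

≋-refl : ∀ {u} → u ≋ u
≋-refl = ≾-refl , ≾-refl

≋-sym : ∀ {u v} → u ≋ v → v ≋ u
≋-sym (p , q) = q , p

≋-trans : ∀ {u v w} → u ≋ v → v ≋ w → u ≋ w
≋-trans (p , p′) (q , q′) = ≾-trans p q , ≾-trans q′ p′

≗⇒≋ : ∀ {u v} → (∀ n → u n ≡ v n) → u ≋ v
≗⇒≋ h = ≤⇒≾ (ℚ.≤-reflexive ∘ h) , ≤⇒≾ (ℚ.≤-reflexive ∘ sym ∘ h)

≋-+ : ∀ {u v u′ v′} → u ≋ v → u′ ≋ v′ → u ⊕ u′ ≋ v ⊕ v′
≋-+ (p , p′) (q , q′) = ≾-+ p q , ≾-+ p′ q′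

≋-− : ∀ {u v u′ v′} → u ≋ v → u′ ≋ v′ → u ⊖ u′ ≋ v ⊖ v′
≋-− (p , p′) (q , q′) = ≾-− p q′ , ≾-− p′ q

≋-*ʳ : ∀ {u v w} → Unit w → u ≋ v → u ⊛ w ≋ v ⊛ w
≋-*ʳ 1w (p , q) = ≾-* 1w p , ≾-* 1w q

≋-*ˡ : ∀ {u v w} → Unit w → u ≋ v → w ⊛ u ≋ w ⊛ v
≋-*ˡ 1w (p , q) = ≾-*ˡ 1w p , ≾-*ˡ 1w q

unit-* : ∀ {u v} → Unit u → Unit v → Unit (u ⊛ v)
unit-* {u} {v} 1u 1v n =
  0≤* (proj₁ (1u n)) (proj₁ (1v n)) ,
  ℚ.≤-trans (*-monoˡ (v n) (proj₁ (1v n)) (proj₂ (1u n)))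
    (subst (_≤ 1ℚ) (sym (ℚ.*-identityˡ (v n))) (proj₂ (1v n)))

unit-1 : Unit (const 1ℚ)
unit-1 n = ℚ.<⇒≤ 0<1 , ℚ.≤-refl

≾-const : ∀ {p q} → const p ≾ const q → p ≤ q
≾-const {p} {q} h = ℚ.≮⇒≥ λ q<p →
  let _ , p< = ev-witness (within h (p - q) (<-by q<p (eq₁ p q)))
  in ℚ.<-irrefl refl (subst (p <_) (eq₂ p q) p<)
  where
  eq₁ : ∀ p q → p - q ≡ (p - q) - 0ℚ
  eq₁ = solve-∀ ℚ-ring
  eq₂ : ∀ p q → q + (p - q) ≡ p
  eq₂ = solve-∀ ℚ-ring

≋⇒∣-∣ : ∀ {u v} → u ≋ v → ∀ ε → 0ℚ < ε → Ev λ n → ∣ u n - v n ∣ < ε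
≋⇒∣-∣ {u} {v} (p , q) ε 0<ε = ev-map₂ (λ n → ⇒∣-∣< (u n) (v n)) (within p ε 0<ε) (within q ε 0<ε)

∣-∣⇒≋ : ∀ {u v} → (∀ ε → 0ℚ < ε → Ev λ n → ∣ u n - v n ∣ < ε) → u ≋ v
∣-∣⇒≋ {u} {v} h = mk≾ (λ ε 0<ε → ev-map (λ n → ∣-∣<⇒ˡ (u n) (v n)) (h ε 0<ε))
        , mk≾ (λ ε 0<ε → ev-map (λ n → ∣-∣<⇒ʳ (u n) (v n)) (h ε 0<ε))

triangle : ∀ p q r {δ ε} → ∣ p - q ∣ < δ → ∣ q - r ∣ < ε → ∣ p - r ∣ < δ + ε
triangle p q r {δ} {ε} a b = ⇒∣-∣< p r
  (<-by (ℚ.+-mono-< (∣-∣<⇒ˡ p q a) (∣-∣<⇒ˡ q r b)) (eq p q r δ ε))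
  (<-by (ℚ.+-mono-< (∣-∣<⇒ʳ p q a) (∣-∣<⇒ʳ q r b)) (eq′ p q r δ ε))
  where
  eq : ∀ p q r δ ε → ((q + δ) + (r + ε)) - (p + q) ≡ (r + (δ + ε)) - p
  eq = solve-∀ ℚ-ring
  eq′ : ∀ p q r δ ε → ((p + δ) + (q + ε)) - (q + r) ≡ (p + (δ + ε)) - r
  eq′ = solve-∀ ℚ-ring

cauchy-≋ : ∀ {u v} → u ≋ v → Cauchy u → Cauchy v
cauchy-≋ {u} {v} u≋v cu ε 0<ε =
  let h = ½ * (½ * ε)
      0<h = 0<½* (0<½* 0<ε)
      M , close = cu (½ * ε) (0<½* 0<ε)
      N , near = ≋⇒∣-∣ u≋v h 0<h
  in M ℕ.⊔ N , λ m n m≥ n≥ → subst (∣ v m - v n ∣ <_) (eq ε)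
       (triangle (v m) (u n) (v n) (triangle (v m) (u m) (u n)
         (subst (_< h) (∣-∣-sym (u m) (v m)) (near m (ℕ.m⊔n≤o⇒n≤o M N m≥)))
         (close m n (ℕ.m⊔n≤o⇒m≤o M N m≥) (ℕ.m⊔n≤o⇒m≤o M N n≥)))
         (near n (ℕ.m⊔n≤o⇒n≤o M N n≥)))
  where
  eq : ∀ ε → ½ * (½ * ε) + ½ * ε + ½ * (½ * ε) ≡ ε
  eq = solve-∀ ℚ-ring

cauchy-+ : ∀ u v → Cauchy u → Cauchy v → Cauchy (u ⊕ v)
cauchy-+ u v cu cv = cauchy (mkℝ u cu +ᴿ mkℝ v cv)

cauchy-− : ∀ u v → Cauchy u → Cauchy v → Cauchy (u ⊖ v)
cauchy-− u v cu cv = cauchy (mkℝ u cu -ᴿ mkℝ v cv)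

cauchy-* : ∀ u v → Cauchy u → Cauchy v → Cauchy (u ⊛ v)
cauchy-* u v cu cv = cauchy (mkℝ u cu *ᴿ mkℝ v cv)

cauchy-const : ∀ q → Cauchy (const q)
cauchy-const q = cauchy (fromℚ q)

<ᴿ⇒≾ : ∀ {x y} → x <ᴿ y → seq x ≾ seq y
<ᴿ⇒≾ {x} {y} (δ , 0<δ , x<y) = mk≾ λ ε 0<ε → ev-map
  (λ n h → <-by (ℚ.+-mono-< (ℚ.+-mono-< h 0<δ) 0<ε) (eq (seq x n) (seq y n) δ ε)) x<y
  where
  eq : ∀ x y δ ε → (y + δ + ε) - (x + δ + 0ℚ + 0ℚ) ≡ (y + ε) - x
  eq = solve-∀ ℚ-ring

module RealOrder (em : ExcludedMiddle 0ℓ) where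

  open Logic em

  -- In other words, v < u as real numbers.
  ⋠⇒< : ∀ {u v} → Cauchy u → Cauchy v → ¬ (u ≾ v) →
        ∃ λ δ → 0ℚ < δ × Ev λ n → v n + δ < u n
  ⋠⇒< {u} {v} cu cv u⋠v =
    let ε , ¬h      = ¬∀⇒∃¬ (u⋠v ∘ mk≾)
        0<ε , ¬ev   = ¬∀⇒∃¬ ¬h
        h           = ½ * (½ * ε)
        0<h         = 0<½* (0<½* 0<ε)
        M , u-close = cu h 0<h
        N , v-close = cv h 0<h
        K = M ℕ.⊔ N
        k , ¬k      = ¬∀⇒∃¬ λ all → ¬ev (K , all)
        K≤k , k≮    = ¬∀⇒∃¬ ¬k
        v+ε≤u       = ℚ.≮⇒≥ k≮
    in ½ * ε , 0<½* 0<ε , K , λ n K≤n → <-by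
         (ℚ.+-mono-< (ℚ.+-mono-≤-< v+ε≤u
           (∣-∣<⇒ˡ (u k) (u n) (u-close k n (ℕ.m⊔n≤o⇒m≤o M N K≤k) (ℕ.m⊔n≤o⇒m≤o M N K≤n))))
           (∣-∣<⇒ʳ (v k) (v n) (v-close k n (ℕ.m⊔n≤o⇒n≤o M N K≤k) (ℕ.m⊔n≤o⇒n≤o M N K≤n))))
         (eq (u k) (v k) (u n) (v n) ε)
    where
    eq : ∀ a b c d ε →
      (a + (c + ½ * (½ * ε)) + (b + ½ * (½ * ε))) - (b + ε + a + d) ≡ c - (d + ½ * ε)
    eq = solve-∀ ℚ-ring

  ≾-total : ∀ {u v} → Cauchy u → Cauchy v → ¬ (u ≾ v) → v ≾ u
  ≾-total {u} {v} cu cv u⋠v = <ᴿ⇒≾ {mkℝ v cv} {mkℝ u cu} (⋠⇒< cu cv u⋠v)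

-- Means and densities

ι : ℕ → ℚ
ι n = ℤ.+ n ℚ./ 1

inv : ℕ → ℚ
inv n = ℤ.1ℤ ℚ./ suc n

toℚᵘ-/ : ∀ i n → toℚᵘ (i ℚ./ suc n) ℚᵘ.≃ ℚᵘ.mkℚᵘ i n
toℚᵘ-/ i n = ℚ.toℚᵘ-fromℚᵘ (ℚᵘ.mkℚᵘ i n)

/≡*inv : ∀ i n → i ℚ./ suc n ≡ (i ℚ./ 1) * inv n
/≡*inv i n = ℚ.toℚᵘ-injective (ℚᵘ.≃-trans (toℚᵘ-/ i n) (ℚᵘ.≃-trans (ℚᵘ.*≡* eq)
  (ℚᵘ.≃-sym (ℚᵘ.≃-trans (ℚ.toℚᵘ-homo-* (i ℚ./ 1) (inv n))
    (ℚᵘ.*-cong (toℚᵘ-/ i 0) (toℚᵘ-/ ℤ.1ℤ n))))))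
  where
  eq : i ℤ.* ℤ.+ (suc n ℕ.+ 0) ≡ i ℤ.* ℤ.1ℤ ℤ.* ℤ.+ suc n
  eq = cong₂ ℤ._*_ (sym (ℤ.*-identityʳ i)) (cong ℤ.+_ (ℕ.+-identityʳ (suc n)))

ι-suc : ∀ n → ι (suc n) ≡ 1ℚ + ι n
ι-suc n = ℚ.toℚᵘ-injective (ℚᵘ.≃-trans (toℚᵘ-/ (ℤ.+ suc n) 0) (ℚᵘ.≃-trans (ℚᵘ.*≡* eq)
  (ℚᵘ.≃-sym (ℚᵘ.≃-trans (ℚ.toℚᵘ-homo-+ 1ℚ (ι n))
    (ℚᵘ.+-cong (ℚᵘ.≃-refl {toℚᵘ 1ℚ}) (toℚᵘ-/ (ℤ.+ n) 0))))))
  where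
  eq : ℤ.+ suc n ℤ.* ℤ.1ℤ ≡ (ℤ.1ℤ ℤ.* ℤ.1ℤ ℤ.+ ℤ.+ n ℤ.* ℤ.1ℤ) ℤ.* ℤ.1ℤ
  eq = cong (λ i → (ℤ.1ℤ ℤ.+ i) ℤ.* ℤ.1ℤ) (sym (ℤ.*-identityʳ (ℤ.+ n)))

ι*inv : ∀ n → ι (suc n) * inv n ≡ 1ℚ
ι*inv n = trans (sym (/≡*inv (ℤ.+ suc n) n)) (ℚ.toℚᵘ-injective
  (ℚᵘ.≃-trans (toℚᵘ-/ (ℤ.+ suc n) n) (ℚᵘ.*≡* (ℤ.*-comm (ℤ.+ suc n) ℤ.1ℤ))))

0<inv : ∀ n → 0ℚ < inv n
0<inv n = ℚ.positive⁻¹ (inv n) {{ℚ.normalize-pos 1 (suc n)}}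

ι-+ : ∀ m n → ι m ≤ ι (n ℕ.+ m)
ι-+ m zero = ℚ.≤-refl
ι-+ m (suc n) = ℚ.≤-trans (ι-+ m n) (subst (ι (n ℕ.+ m) ≤_) (sym (ι-suc (n ℕ.+ m)))
  (≤-by (ℚ.<⇒≤ 0<1) (eq (ι (n ℕ.+ m)))))
  where
  eq : ∀ a → 1ℚ - 0ℚ ≡ (1ℚ + a) - a
  eq = solve-∀ ℚ-ring

ι-mono : ∀ {m n} → m ℕ.≤ n → ι m ≤ ι n
ι-mono {m} {n} m≤n = subst (λ k → ι m ≤ ι k) (ℕ.m∸n+n≡m m≤n) (ι-+ m (n ℕ.∸ m))

<ι : ∀ p → ∃ λ n → p < ι n
-- The denominator is at least `1`, so one more than the size of the numerator suffices.
<ι p@(mkℚ i d _) = suc ℤ.∣ i ∣ , ℚ.toℚᵘ-cancel-<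
  (ℚᵘ.<-respʳ-≃ (ℚᵘ.≃-sym (toℚᵘ-/ (ℤ.+ suc ℤ.∣ i ∣) 0)) (ℚᵘ.*<* (ℤ.≤-<-trans
    (ℤ.≤-reflexive (ℤ.*-identityʳ i)) (ℤ.≤-<-trans (i≤∣i∣ i)
    (ℤ.<-≤-trans (ℤ.+<+ (ℕ.n<1+n ℤ.∣ i ∣))
      (subst (ℤ.+ suc ℤ.∣ i ∣ ℤ.≤_) (ℤ.pos-* (suc ℤ.∣ i ∣) (suc d))
        (ℤ.+≤+ (ℕ.m≤m*n (suc ℤ.∣ i ∣) (suc d)))))))))
  where
  i≤∣i∣ : ∀ i → i ℤ.≤ ℤ.+ ℤ.∣ i ∣
  i≤∣i∣ (ℤ.+ n)    = ℤ.≤-refl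
  i≤∣i∣ ℤ.-[1+ n ] = ℤ.-≤+

archimedean : ∀ K ε → 0ℚ < ε → ∃ λ n → K < ι n * ε
archimedean K ε 0<ε =
  let n , h = <ι (K * 1/ε) in
  n , subst (_< ι n * ε)
    (trans (ℚ.*-assoc K 1/ε ε) (trans (cong (K *_) (ℚ.*-inverseˡ ε)) (ℚ.*-identityʳ K)))
    (ℚ.*-monoˡ-<-pos ε h)
  where
  instance
    ε-pos : Positive ε
    ε-pos = positive 0<ε
    ε≢0 : ℚ.NonZero ε
    ε≢0 = ℚ.pos⇒nonZero ε
  1/ε = 1/ ε

partial : Seq → Seq
partial f zero = 0ℚ
partial f (suc n) = f n + partial f n

-- Averages the first `suc n` terms, in agreement with the index shift in `HasDensity`.
mean : Seq → Seq
mean f n = partial f (suc n) * inv n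

partial-cong : ∀ {f g} → (∀ n → f n ≡ g n) → ∀ n → partial f n ≡ partial g n
partial-cong h zero    = refl
partial-cong h (suc n) = cong₂ _+_ (h n) (partial-cong h n)

partial-+ : ∀ f g n → partial (f ⊕ g) n ≡ partial f n + partial g n
partial-+ f g zero    = refl
partial-+ f g (suc n) = trans (cong ((f n + g n) +_) (partial-+ f g n))
  (eq (f n) (g n) (partial f n) (partial g n))
  where
  eq : ∀ a b c d → (a + b) + (c + d) ≡ (a + c) + (b + d)
  eq = solve-∀ ℚ-ring

partial-− : ∀ f g n → partial (f ⊖ g) n ≡ partial f n - partial g n
partial-− f g zero    = refl
partial-− f g (suc n) = trans (cong ((f n - g n) +_) (partial-− f g n))
  (eq (f n) (g n) (partial f n) (partial g n))
  where
  eq : ∀ a b c d → (a - b) + (c - d) ≡ (a + c) - (b + d)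
  eq = solve-∀ ℚ-ring

partial-*ˡ : ∀ c f n → partial (const c ⊛ f) n ≡ c * partial f n
partial-*ˡ c f zero    = sym (ℚ.*-zeroʳ c)
partial-*ˡ c f (suc n) = trans (cong (c * f n +_) (partial-*ˡ c f n))
  (sym (ℚ.*-distribˡ-+ c (f n) (partial f n)))

partial-mono : ∀ {f g} → (∀ n → f n ≤ g n) → ∀ n → partial f n ≤ partial g n
partial-mono h zero    = ℚ.≤-refl
partial-mono h (suc n) = ℚ.+-mono-≤ (h n) (partial-mono h n)

partial-const : ∀ c n → partial (const c) n ≡ ι n * c
partial-const c zero    = sym (ℚ.*-zeroˡ c)
partial-const c (suc n) = trans (cong (c +_) (partial-const c n))
  (trans (eq c (ι n)) (cong (_* c) (sym (ι-suc n))))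
  where
  eq : ∀ c a → c + a * c ≡ (1ℚ + a) * c
  eq = solve-∀ ℚ-ring

mean-cong : ∀ {f g} → (∀ n → f n ≡ g n) → mean f ≋ mean g
mean-cong h = ≗⇒≋ λ n → cong (_* inv n) (partial-cong h (suc n))

mean-+ : ∀ f g → mean (f ⊕ g) ≋ mean f ⊕ mean g
mean-+ f g = ≗⇒≋ λ n → trans (cong (_* inv n) (partial-+ f g (suc n)))
  (ℚ.*-distribʳ-+ (inv n) (partial f (suc n)) (partial g (suc n)))

mean-− : ∀ f g → mean (f ⊖ g) ≋ mean f ⊖ mean g
mean-− f g = ≗⇒≋ λ n → trans (cong (_* inv n) (partial-− f g (suc n)))
  (eq (partial f (suc n)) (partial g (suc n)) (inv n))
  where
  eq : ∀ a b c → (a - b) * c ≡ a * c - b * c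
  eq = solve-∀ ℚ-ring

mean-*ˡ : ∀ c f → mean (const c ⊛ f) ≋ const c ⊛ mean f
mean-*ˡ c f = ≗⇒≋ λ n → trans (cong (_* inv n) (partial-*ˡ c f (suc n)))
  (ℚ.*-assoc c (partial f (suc n)) (inv n))

mean-mono : ∀ {f g} → (∀ n → f n ≤ g n) → ∀ n → mean f n ≤ mean g n
mean-mono h n = *-monoˡ (inv n) (ℚ.<⇒≤ (0<inv n)) (partial-mono h (suc n))

mean-const : ∀ c n → mean (const c) n ≡ c
mean-const c n = trans (cong (_* inv n) (partial-const c (suc n)))
  (trans (eq (ι (suc n)) c (inv n)) (trans (cong (_* c) (ι*inv n)) (ℚ.*-identityˡ c)))
  where
  eq : ∀ a b c → a * b * c ≡ (a * c) * b
  eq = solve-∀ ℚ-ring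

unit-mean : ∀ {f} → Unit f → Unit (mean f)
unit-mean {f} 1f n =
  subst (_≤ mean f n) (mean-const 0ℚ n) (mean-mono (proj₁ ∘ 1f) n) ,
  subst (mean f n ≤_) (mean-const 1ℚ n) (mean-mono (proj₂ ∘ 1f) n)

BoundedSums : Seq → Set
BoundedSums f = ∃ λ K → 0ℚ ≤ K × ∀ n → ∣ partial f n ∣ ≤ K

-- The means are bounded by `K * inv n`, which the Archimedean property makes small.
boundedSums⇒mean≋0 : ∀ {f} → BoundedSums f → mean f ≋ const 0ℚ
boundedSums⇒mean≋0 {f} (K , 0≤K , bound) = ∣-∣⇒≋ λ ε 0<ε →
  let N , K<Nε = archimedean K ε 0<ε in N , λ n N≤n →
  let
    K<nε : K < ι (suc n) * ε
    K<nε = ℚ.<-≤-trans K<Nε (*-monoˡ ε (ℚ.<⇒≤ 0<ε) (ι-mono (ℕ.m≤n⇒m≤1+n N≤n)))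
    h : K * inv n < ε
    h = subst (K * inv n <_)
      (trans (eq (ι (suc n)) ε (inv n)) (trans (cong (_* ε) (ι*inv n)) (ℚ.*-identityˡ ε)))
      (ℚ.*-monoˡ-<-pos (inv n) {{positive (0<inv n)}} K<nε)
  in subst (_< ε) (sym (trans (cong ∣_∣ (ℚ.+-identityʳ (mean f n)))
       (trans (ℚ.∣p*q∣≡∣p∣*∣q∣ (partial f (suc n)) (inv n))
         (cong (∣ partial f (suc n) ∣ *_) (ℚ.0≤p⇒∣p∣≡p (ℚ.<⇒≤ (0<inv n)))))))
     (ℚ.≤-<-trans (*-monoˡ (inv n) (ℚ.<⇒≤ (0<inv n)) (bound (suc n))) h)
  where
  eq : ∀ a b c → a * b * c ≡ (a * c) * b
  eq = solve-∀ ℚ-ring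

bit : Bool → ℚ
bit b = if b then 1ℚ else 0ℚ

𝟙 : Subset → Seq
𝟙 A n = bit (A n)

ρ : Subset → Seq
ρ A = mean (𝟙 A)

unit-bit : ∀ b → 0ℚ ≤ bit b × bit b ≤ 1ℚ
unit-bit true  = ℚ.<⇒≤ 0<1 , ℚ.≤-refl
unit-bit false = ℚ.≤-refl , ℚ.<⇒≤ 0<1

unit-𝟙 : ∀ A → Unit (𝟙 A)
unit-𝟙 A n = unit-bit (A n)

unit-ρ : ∀ A → Unit (ρ A)
unit-ρ A = unit-mean (unit-𝟙 A)

bit-∧ : ∀ a b → bit (a ∧ b) ≡ bit a * bit b
bit-∧ true  b = sym (ℚ.*-identityˡ (bit b))
bit-∧ false b = sym (ℚ.*-zeroˡ (bit b))

bit-not : ∀ b → bit (not b) ≡ 1ℚ - bit b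
bit-not true  = refl
bit-not false = refl

bit-∨ : ∀ a b → bit (a ∨ b) ≡ (bit a + bit b) - bit a * bit b
bit-∨ true  true  = refl
bit-∨ true  false = refl
bit-∨ false true  = refl
bit-∨ false false = refl

countBelow≡partial : ∀ A n → ι (countBelow A n) ≡ partial (𝟙 A) n
countBelow≡partial A zero = refl
countBelow≡partial A (suc n) with A n
... | true  = trans (ι-suc (countBelow A n)) (cong (1ℚ +_) (countBelow≡partial A n))
... | false = trans (countBelow≡partial A n) (sym (ℚ.+-identityˡ (partial (𝟙 A) n)))

frequency≡ρ : ∀ A n → ℤ.+ countBelow A (suc n) ℚ./ suc n ≡ ρ A n
frequency≡ρ A n = trans (/≡*inv (ℤ.+ countBelow A (suc n)) n)
  (cong (_* inv n) (countBelow≡partial A (suc n)))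

-- `HasDensity` compares a fixed frequency with late terms of `x`. As `x` is Cauchy, the comparison
-- with one late term `seq x k` carries over to the diagonal term `seq x n`.
hasDensity⇒≋ : ∀ {A x} → HasDensity A x → ρ A ≋ seq x
hasDensity⇒≋ {A} {x} h = ∣-∣⇒≋ λ ε 0<ε →
  let δ = ½ * ε
      0<δ = 0<½* 0<ε
      N , near = h (fromℚ δ) (½ * δ , 0<½* 0<δ , ev-all λ _ → <-by (0<½* 0<δ) (eq₁ δ))
      M , close = cauchy x δ 0<δ
  in N ℕ.⊔ M , λ n n≥ →
  let η , 0<η , K , h′ = near n (ℕ.m⊔n≤o⇒m≤o N M n≥)
      k = K ℕ.⊔ M
      r = ℤ.+ countBelow A (suc n) ℚ./ suc n
      |r-x|<δ : ∣ r - seq x k ∣ < δ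
      |r-x|<δ = ℚ.<-trans
        (<-by 0<η (eq₂ ∣ r - seq x k ∣ η)) (h′ k (ℕ.m≤m⊔n K M))
  in subst₂ (λ a b → ∣ a - seq x n ∣ < b) (frequency≡ρ A n) (½*+½* ε)
       (triangle (ℤ.+ countBelow A (suc n) ℚ./ suc n) (seq x k) (seq x n) |r-x|<δ
         (close k n (ℕ.m≤n⊔m K M) (ℕ.m⊔n≤o⇒n≤o N M n≥)))
  where
  eq₁ : ∀ δ → ½ * δ - 0ℚ ≡ δ - (0ℚ + ½ * δ)
  eq₁ = solve-∀ ℚ-ring
  eq₂ : ∀ a η → η - 0ℚ ≡ (a + η) - a
  eq₂ = solve-∀ ℚ-ring

≋⇒hasDensity : ∀ {A x} → ρ A ≋ seq x → HasDensity A x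
≋⇒hasDensity {A} {x} h ε (δ , 0<δ , K , 0+δ<ε) =
  let γ = ½ * (½ * δ)
      0<γ = 0<½* (0<½* 0<δ)
      N , near = ≋⇒∣-∣ h γ 0<γ
      M , close = cauchy x γ 0<γ
  in N ℕ.⊔ M , λ n n≥ → ½ * δ , 0<½* 0<δ , K ℕ.⊔ M , λ k k≥ →
  let r = ℤ.+ countBelow A (suc n) ℚ./ suc n
      |r-x|<½δ : ∣ r - seq x k ∣ < ½ * δ
      |r-x|<½δ = subst₂ (λ a b → ∣ a - seq x k ∣ < b) (sym (frequency≡ρ A n)) (½*+½* (½ * δ))
        (triangle (ρ A n) (seq x n) (seq x k) (near n (ℕ.m⊔n≤o⇒m≤o N M n≥))
          (close n k (ℕ.m⊔n≤o⇒n≤o N M n≥) (ℕ.m⊔n≤o⇒n≤o K M k≥)))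
  in ℚ.<-trans (<-by |r-x|<½δ (eq ∣ r - seq x k ∣ δ)) (0+δ<ε k (ℕ.m⊔n≤o⇒m≤o K M k≥))
  where
  eq : ∀ a δ → ½ * δ - a ≡ (0ℚ + δ) - (a + ½ * δ)
  eq = solve-∀ ℚ-ring

-- Independence

≾-slack : ∀ {u v} → (∀ η → 0ℚ < η → u ≾ v ⊕ const η) → u ≾ v
≾-slack {u} {v} h = ≾-intro λ ε 0<ε →
  ev-map (λ n → subst (u n <_) (ℚ.+-assoc (v n) ε ε)) (within (h ε 0<ε) ε 0<ε)

-- Multiplies running frequencies instead of limits, so that no densities have to be chosen.
∏ρ : List Subset → Seq
∏ρ = foldr (λ A u → ρ A ⊛ u) (const 1ℚ)

unit-∏ρ : ∀ F → Unit (∏ρ F)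
unit-∏ρ []      = unit-1
unit-∏ρ (A ∷ F) = unit-* (unit-ρ A) (unit-∏ρ F)

infix 4 _⫫_

-- Stated for arbitrary sequences rather than for indicators, so that independence is preserved by
-- sums and differences.
_⫫_ : Seq → Family → Set
f ⫫ 𝒜 = ∀ F → Distinct F → All 𝒜 F → mean (f ⊛ 𝟙 (⋂ F)) ≋ mean f ⊛ ∏ρ F

-- The density exists and keeps a rational margin `δ` from `0` and `1`; these margins later label
-- the classes into which `ℬ` is cut.
IsProper : Subset → Set
IsProper A = Cauchy (ρ A) ×
  ∃ λ δ → 0ℚ < δ × const δ ≾ ρ A × ρ A ≾ const (1ℚ - δ)

-- Distinctness is a hypothesis of the product formula, not a demand on the list, so lists with
-- repetitions can be good and Tukey's lemma applies.
Good : Pred Subset 0ℓ → List Subset → Set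
Good P F = All P F × (Distinct F → ρ (⋂ F) ≋ ∏ρ F)

-- This is `AllGood` for the property `Good P`. With `IsProper` for `P` and a nonempty family it is
-- equivalent to d-independence, as `core⇒isDIndependent` and `isDIndependent⇒core` show.
Core : Pred Subset 0ℓ → Family → Set
Core P 𝒜 = ∀ F → All 𝒜 F → Good P F

core-⊆ : ∀ {P 𝒜 ℬ} → ℬ ⊆ 𝒜 → Core P 𝒜 → Core P ℬ
core-⊆ ℬ⊆𝒜 core F allF = core F (All.map ℬ⊆𝒜 allF)

core-map : ∀ {P Q 𝒜} → P ⊆ Q → Core P 𝒜 → Core Q 𝒜
core-map P⊆Q core F allF = All.map P⊆Q (proj₁ (core F allF)) , proj₂ (core F allF)

core-member : ∀ {P 𝒜 A} → Core P 𝒜 → A ∈ 𝒜 → P A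
core-member core A∈𝒜 = All.head (proj₁ (core _ (A∈𝒜 ∷ [])))

core-indep : ∀ {P 𝒜} → Core P 𝒜 → ∀ F → Distinct F → All 𝒜 F → ρ (⋂ F) ≋ ∏ρ F
core-indep core F dF allF = proj₂ (core F allF) dF

⫫-⊆ : ∀ {f 𝒜 ℬ} → ℬ ⊆ 𝒜 → f ⫫ 𝒜 → f ⫫ ℬ
⫫-⊆ ℬ⊆𝒜 f⫫𝒜 F dF allF = f⫫𝒜 F dF (All.map ℬ⊆𝒜 allF)

⫫-1 : ∀ {P 𝒜} → Core P 𝒜 → const 1ℚ ⫫ 𝒜
⫫-1 core F dF allF = ≋-trans (mean-cong λ n → ℚ.*-identityˡ (𝟙 (⋂ F) n))
  (≋-trans (core-indep core F dF allF) (≗⇒≋ λ n →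
    sym (trans (cong (_* ∏ρ F n) (mean-const 1ℚ n)) (ℚ.*-identityˡ (∏ρ F n)))))

⫫-0 : ∀ {𝒜} → const 0ℚ ⫫ 𝒜
⫫-0 F dF allF = ≋-trans (mean-cong λ n → ℚ.*-zeroˡ (𝟙 (⋂ F) n)) (≗⇒≋ λ n →
  trans (mean-const 0ℚ n) (sym (trans (cong (_* ∏ρ F n) (mean-const 0ℚ n)) (ℚ.*-zeroˡ (∏ρ F n)))))

⫫-+ : ∀ {f g 𝒜} → f ⫫ 𝒜 → g ⫫ 𝒜 → f ⊕ g ⫫ 𝒜
⫫-+ {f} {g} f⫫ g⫫ F dF allF =
  ≋-trans (mean-cong λ n → ℚ.*-distribʳ-+ (𝟙 (⋂ F) n) (f n) (g n))
  (≋-trans (mean-+ (f ⊛ 𝟙 (⋂ F)) (g ⊛ 𝟙 (⋂ F)))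
  (≋-trans (≋-+ (f⫫ F dF allF) (g⫫ F dF allF))
  (≋-trans (≗⇒≋ λ n → sym (ℚ.*-distribʳ-+ (∏ρ F n) (mean f n) (mean g n)))
  (≋-*ʳ (unit-∏ρ F) (≋-sym (mean-+ f g))))))

⫫-− : ∀ {f g 𝒜} → f ⫫ 𝒜 → g ⫫ 𝒜 → f ⊖ g ⫫ 𝒜
⫫-− {f} {g} f⫫ g⫫ F dF allF =
  ≋-trans (mean-cong λ n → distrib (f n) (g n) (𝟙 (⋂ F) n))
  (≋-trans (mean-− (f ⊛ 𝟙 (⋂ F)) (g ⊛ 𝟙 (⋂ F)))
  (≋-trans (≋-− (f⫫ F dF allF) (g⫫ F dF allF))
  (≋-trans (≗⇒≋ λ n → sym (distrib (mean f n) (mean g n) (∏ρ F n)))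
  (≋-*ʳ (unit-∏ρ F) (≋-sym (mean-− f g))))))
  where
  distrib : ∀ a b c → (a - b) * c ≡ a * c - b * c
  distrib = solve-∀ ℚ-ring

module _ {f 𝒜 X} (f⫫𝒜 : f ⫫ 𝒜) (X∈𝒜 : X ∈ 𝒜) where

  private
    split : ∀ F n → (f ⊛ 𝟙 X ⊛ 𝟙 (⋂ F)) n ≡ (f ⊛ 𝟙 (⋂ (X ∷ F))) n
    split F n = trans (ℚ.*-assoc (f n) (𝟙 X n) (𝟙 (⋂ F) n))
      (cong (f n *_) (sym (bit-∧ (X n) (⋂ F n))))

  ⫫-mean : mean (f ⊛ 𝟙 X) ≋ mean f ⊛ ρ X
  ⫫-mean = ≋-trans (mean-cong λ n → trans (sym (ℚ.*-identityʳ ((f ⊛ 𝟙 X) n))) (split [] n))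
    (≋-trans (f⫫𝒜 (X ∷ []) ([] ∷ []) (X∈𝒜 ∷ []))
    (≗⇒≋ λ n → cong (mean f n *_) (ℚ.*-identityʳ (ρ X n))))

  -- A distinct list from `ℬ` stays distinct with `X` in front, so independence of `f` applies to
  -- `X ∷ F`; the factor for `X` is then absorbed by `⫫-mean`.
  ⫫-* : ∀ {ℬ} → ℬ ⊆ 𝒜 → X ∉ ℬ → f ⊛ 𝟙 X ⫫ ℬ
  ⫫-* ℬ⊆𝒜 X∉ℬ F dF allF = ≋-trans (mean-cong (split F))
    (≋-trans (f⫫𝒜 (X ∷ F) (All.map (λ A∈ℬ X≡A → X∉ℬ (subst _ (sym X≡A) A∈ℬ)) allF ∷ dF)
        (X∈𝒜 ∷ All.map ℬ⊆𝒜 allF))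
    (≋-trans (≗⇒≋ λ n → sym (ℚ.*-assoc (mean f n) (ρ X n) (∏ρ F n)))
    (≋-*ʳ (unit-∏ρ F) (≋-sym ⫫-mean))))

⋂-↭ : ∀ {F G} → F ↭ G → ∀ n → ⋂ F n ≡ ⋂ G n
⋂-↭ Perm.refl        n = refl
⋂-↭ (prep A p)       n = cong (A n ∧_) (⋂-↭ p n)
⋂-↭ {_} {_ ∷ _ ∷ G} (swap A B p) n = trans (cong (λ b → A n ∧ B n ∧ b) (⋂-↭ p n))
  (trans (sym (Bool.∧-assoc (A n) (B n) (⋂ G n)))
  (trans (cong (_∧ ⋂ G n) (Bool.∧-comm (A n) (B n)))
  (Bool.∧-assoc (B n) (A n) (⋂ G n))))
⋂-↭ (Perm.trans p q) n = trans (⋂-↭ p n) (⋂-↭ q n)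

∏ρ-↭ : ∀ {F G} → F ↭ G → ∀ n → ∏ρ F n ≡ ∏ρ G n
∏ρ-↭ Perm.refl        n = refl
∏ρ-↭ (prep A p)       n = cong (ρ A n *_) (∏ρ-↭ p n)
∏ρ-↭ {_} {_ ∷ _ ∷ G} (swap A B p) n = trans (cong (λ b → ρ A n * (ρ B n * b)) (∏ρ-↭ p n))
  (eq (ρ A n) (ρ B n) (∏ρ G n))
  where
  eq : ∀ a b c → a * (b * c) ≡ b * (a * c)
  eq = solve-∀ ℚ-ring
∏ρ-↭ (Perm.trans p q) n = trans (∏ρ-↭ p n) (∏ρ-↭ q n)

extract : ∀ {𝒜 : Family} {Y} (F : List Subset) → Distinct F → All (𝒜 ▹ Y) F →
  All 𝒜 F ⊎ ∃ λ G → All 𝒜 G × Distinct G × F ↭ Y ∷ G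
extract [] _ _ = inj₁ []
extract (A ∷ F) (A∉F ∷ dF) (inj₂ refl ∷ allF) =
  inj₂ (F , All.zipWith (λ { (inj₁ B∈𝒜 , _) → B∈𝒜 ; (inj₂ B≡A , A≢B) → ⊥-elim (A≢B (sym B≡A)) })
    (allF , A∉F) , dF , ↭-refl)
extract (A ∷ F) (A∉F ∷ dF) (inj₁ A∈𝒜 ∷ allF) with extract F dF allF
... | inj₁ allF′ = inj₁ (A∈𝒜 ∷ allF′)
... | inj₂ (G , allG , dG , F↭) =
  inj₂ (A ∷ G , A∈𝒜 ∷ allG , All.tail (All-resp-↭ F↭ A∉F) ∷ dG ,
    ↭-trans (prep A F↭) (swap A _ ↭-refl))

-- In a distinct list `Y` occurs at most once. A list without it is covered by `core`; otherwise `Y`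
-- is moved to the front and its independence of the rest is used.
core-▹ : ∀ {P 𝒜 Y} → Core P 𝒜 → P Y → 𝟙 Y ⫫ 𝒜 → Core P (𝒜 ▹ Y)
core-▹ {P} {𝒜} {Y} core PY Y⫫𝒜 F allF =
  All.map (λ { (inj₁ A∈𝒜) → core-member core A∈𝒜 ; (inj₂ refl) → PY }) allF ,
  λ dF → [ core-indep core F dF , (λ { (G , allG , dG , F↭) →
      ≋-trans (mean-cong λ n → trans (cong bit (⋂-↭ F↭ n)) (bit-∧ (Y n) (⋂ G n)))
      (≋-trans (Y⫫𝒜 G dG allG) (≗⇒≋ λ n → sym (∏ρ-↭ F↭ n))) })
    ]′ (extract F dF allF)

-- A member independent of its own family would have a density equal to its square. With the margin
-- `δ` this gives `ρ Y ≾ (1 - δ) ρ Y`, hence `δ * δ ≤ 0`.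
⫫⇒∉ : ∀ {𝒜 Y} → IsProper Y → 𝟙 Y ⫫ 𝒜 → Y ∉ 𝒜
⫫⇒∉ {𝒜} {Y} (_ , δ , 0<δ , δ≾ , ≾1-δ) Y⫫𝒜 Y∈𝒜 =
  ℚ.<-irrefl refl (ℚ.<-≤-trans (0<* 0<δ 0<δ) (≾-const δδ≾0))
  where
  square : ρ Y ≾ ρ Y ⊛ ρ Y
  square = ≾-trans (proj₁ (mean-cong λ n → idem (Y n))) (proj₁ (⫫-mean {f = 𝟙 Y} Y⫫𝒜 Y∈𝒜))
    where
    idem : ∀ b → bit b ≡ bit b * bit b
    idem true  = refl
    idem false = refl
  δρ≾0 : const δ ⊛ ρ Y ≾ const 0ℚ
  δρ≾0 = ≾-trans (≤⇒≾ λ n → ℚ.≤-reflexive (eq₁ δ (ρ Y n)))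
    (≾-trans (≾-− (≾-trans square (≾-* (unit-ρ Y) ≾1-δ)) (≾-refl {const (1ℚ - δ) ⊛ ρ Y}))
    (≤⇒≾ λ n → ℚ.≤-reflexive (ℚ.+-inverseʳ ((1ℚ - δ) * ρ Y n))))
    where
    eq₁ : ∀ d r → d * r ≡ r - (1ℚ - d) * r
    eq₁ = solve-∀ ℚ-ring
  δ≤1 : δ ≤ 1ℚ
  δ≤1 = ≾-const (≾-trans δ≾ (≤⇒≾ (proj₂ ∘ unit-ρ Y)))
  δδ≾0 : const (δ * δ) ≾ const 0ℚ
  δδ≾0 = ≾-trans (≾-* {const δ} {ρ Y} {const δ} (λ _ → ℚ.<⇒≤ 0<δ , δ≤1) δ≾)
    (≾-trans (≤⇒≾ λ n → ℚ.≤-reflexive (ℚ.*-comm (ρ Y n) δ)) δρ≾0)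

real-proper : ∀ {A} s → s ∈ ⟨0,1⟩ → ρ A ≋ seq s → IsProper A
real-proper {A} s ((δ , 0<δ , 0+δ<s) , (η , 0<η , s+η<1)) ρA≋s =
  cauchy-≋ (≋-sym ρA≋s) (cauchy s) , δ ⊓ η , 0<⊓ 0<δ 0<η ,
  ≾-trans (mk≾ λ ε 0<ε → ev-map (λ n h → <-by
      (ℚ.+-mono-≤-< (ℚ.p⊓q≤p δ η) (ℚ.+-mono-< h 0<ε)) (eq₁ δ (δ ⊓ η) (seq s n) ε)) 0+δ<s)
    (proj₂ ρA≋s) ,
  ≾-trans (proj₁ ρA≋s)
    (mk≾ λ ε 0<ε → ev-map (λ n h → <-by
      (ℚ.+-mono-≤-< (ℚ.p⊓q≤q δ η) (ℚ.+-mono-< h 0<ε)) (eq₂ η (δ ⊓ η) (seq s n) ε)) s+η<1)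
  where
  eq₁ : ∀ δ m s ε → (δ + (s + ε)) - (m + (0ℚ + δ + 0ℚ)) ≡ (s + ε) - m
  eq₁ = solve-∀ ℚ-ring
  eq₂ : ∀ η m s ε → (η + (1ℚ + ε)) - (m + (s + η + 0ℚ)) ≡ (1ℚ - m + ε) - s
  eq₂ = solve-∀ ℚ-ring

proper-real : ∀ {A} x → IsProper A → ρ A ≋ seq x → x ∈ ⟨0,1⟩
proper-real {A} x (_ , δ , 0<δ , δ≾ , ≾1-δ) ρA≋x =
  (½ * δ , 0<½* 0<δ , ev-map (λ n h → <-by h (eq₁ δ (seq x n)))
    (within (≾-trans δ≾ (proj₁ ρA≋x)) (½ * δ) (0<½* 0<δ))) ,
  (½ * δ , 0<½* 0<δ , ev-map (λ n h → <-by h (eq₂ δ (seq x n)))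
    (within (≾-trans (proj₂ ρA≋x) ≾1-δ) (½ * δ) (0<½* 0<δ)))
  where
  eq₁ : ∀ δ x → (x + ½ * δ) - δ ≡ x - (0ℚ + ½ * δ)
  eq₁ = solve-∀ ℚ-ring
  eq₂ : ∀ δ x → (1ℚ - δ + ½ * δ) - x ≡ 1ℚ - (x + ½ * δ)
  eq₂ = solve-∀ ℚ-ring

-- Thresholds

module Threshold (em : ExcludedMiddle 0ℓ) (ext : Extensionality 0ℓ 0ℓ) where

  open Logic em
  open RealOrder em using (≾-total)

  -- The outcome of comparing a point with the threshold digit by digit; `pivot` means still
  -- undecided.
  data Side : Set where
    below pivot above : Side

  low piv : Side → ℚ
  low below = 1ℚ
  low _     = 0ℚ
  piv pivot = 1ℚ
  piv _     = 0ℚ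

  -- Refines the position of a point relative to the threshold by one binary
  -- digit x of the point and one binary digit b of the threshold.
  refine : Bool → Bool → Side → Side
  refine true  true  pivot = below
  refine false false pivot = above
  refine _     _     side  = side

  -- This and the next three identities make `refine` linear. Membership in the current set counts
  -- as the smaller digit: for the threshold digit `true` the undecided points inside the set drop
  -- below, and for `false` those outside rise above; the others stay undecided.
  refine-low-true : ∀ x σ → low (refine true x σ) ≡ low σ + piv σ * bit x
  refine-low-true true  below = refl
  refine-low-true false below = refl
  refine-low-true true  pivot = refl
  refine-low-true false pivot = refl
  refine-low-true true  above = refl
  refine-low-true false above = refl

  refine-piv-true : ∀ x σ → piv (refine true x σ) ≡ piv σ - piv σ * bit x
  refine-piv-true true  below = refl
  refine-piv-true false below = refl
  refine-piv-true true  pivot = refl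
  refine-piv-true false pivot = refl
  refine-piv-true true  above = refl
  refine-piv-true false above = refl

  refine-low-false : ∀ x σ → low (refine false x σ) ≡ low σ
  refine-low-false true  below = refl
  refine-low-false false below = refl
  refine-low-false true  pivot = refl
  refine-low-false false pivot = refl
  refine-low-false true  above = refl
  refine-low-false false above = refl

  refine-piv-false : ∀ x σ → piv (refine false x σ) ≡ piv σ * bit x
  refine-piv-false true  below = refl
  refine-piv-false false below = refl
  refine-piv-false true  pivot = refl
  refine-piv-false false pivot = refl
  refine-piv-false true  above = refl
  refine-piv-false false above = refl

  refine-below : ∀ b x → refine b x below ≡ below
  refine-below true  true  = refl
  refine-below true  false = refl
  refine-below false true  = refl
  refine-below false false = refl

  refine-above : ∀ b x → refine b x above ≡ above
  refine-above true  true  = refl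
  refine-above true  false = refl
  refine-above false true  = refl
  refine-above false false = refl

  unit-piv : ∀ (σ : ℕ → Side) → Unit (piv ∘ σ)
  unit-piv σ n with σ n
  ... | below = unit-bit false
  ... | pivot = unit-bit true
  ... | above = unit-bit false

  module _ (X : ℕ → Subset) (s : ℝ) where

    -- The indicator of the points decided below once digit `n` of the threshold is taken to be
    -- `true`.
    candidate : ℕ → (ℕ → Side) → Seq
    candidate n σ = (low ∘ σ) ⊕ (piv ∘ σ) ⊛ 𝟙 (X n)

    -- The greedy expansion of `s`: a digit is `true` whenever the mass below does not overshoot
    -- `s`.
    digit : ℕ → (ℕ → Side) → Bool
    digit n σ = test (mean (candidate n σ) ≾ seq s)

    side : ℕ → ℕ → Side
    side zero    m = pivot
    side (suc n) m = refine (digit n (side n)) (X n m) (side n m)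

    -- The points whose binary expansion (X n m)ₙ lies below that of s, where
    -- the expansion of s is taken with respect to the densities of the X n.
    threshold : Subset
    threshold m = test (∃ λ n → side n m ≡ below)

    below-stays : ∀ {n m} k → side n m ≡ below → side (k ℕ.+ n) m ≡ below
    below-stays zero    e = e
    below-stays (suc k) e = trans (cong (refine _ _) (below-stays k e)) (refine-below _ _)

    above-stays : ∀ {n m} k → side n m ≡ above → side (k ℕ.+ n) m ≡ above
    above-stays zero    e = e
    above-stays (suc k) e = trans (cong (refine _ _) (above-stays k e)) (refine-above _ _)

    -- Both decided sides persist, so a point above at stage `n` and below at stage `k` would be
    -- both at stage `n + k`.
    above⇒∉threshold : ∀ {n m} → side n m ≡ above → threshold m ≡ false
    above⇒∉threshold {n} {m} e = eq (threshold m) refl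
      where
      clash : ∀ k → side k m ≡ below → below ≡ above
      clash k e′ = trans (sym (below-stays n e′))
        (trans (cong (λ j → side j m) (ℕ.+-comm n k)) (above-stays k e))
      eq : ∀ b → threshold m ≡ b → b ≡ false
      eq false _ = refl
      eq true  t with test⁻ {∃ λ k → side k m ≡ below} t
      ... | k , e′ with clash k e′
      ... | ()

    low≤threshold : ∀ n m → low (side n m) ≤ 𝟙 threshold m
    low≤threshold n m = go (side n m) refl
      where
      go : ∀ σ → side n m ≡ σ → low σ ≤ 𝟙 threshold m
      go below e = ℚ.≤-reflexive (cong bit (sym (test⁺ {∃ λ k → side k m ≡ below} (n , e))))
      go pivot _ = proj₁ (unit-𝟙 threshold m)
      go above _ = proj₁ (unit-𝟙 threshold m)

    threshold≤low+piv : ∀ n m → 𝟙 threshold m ≤ low (side n m) + piv (side n m)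
    threshold≤low+piv n m = go (side n m) refl
      where
      go : ∀ σ → side n m ≡ σ → 𝟙 threshold m ≤ low σ + piv σ
      go below _ = proj₂ (unit-𝟙 threshold m)
      go pivot _ = proj₂ (unit-𝟙 threshold m)
      go above e = ℚ.≤-reflexive (cong bit (above⇒∉threshold {n} e))

    module _ {P : Pred Subset 0ℓ} {ℋ : Family}
      (core : Core P (λ A → A ∈ ℋ ⊎ ∃ λ n → A ≡ X n))
      (X-injective : ∀ {m n} → X m ≡ X n → m ≡ n)
      (X∉ℋ : ∀ n → X n ∉ ℋ)
      (ρX-cauchy : ∀ n → Cauchy (ρ (X n)))
      {δ : ℚ} (0<δ : 0ℚ < δ)
      (δ≾ρX : ∀ n → const δ ≾ ρ (X n)) (ρX≾1-δ : ∀ n → ρ (X n) ≾ const (1ℚ - δ))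
      (s∈⟨0,1⟩ : s ∈ ⟨0,1⟩)
      where

      Rest : ℕ → Family
      Rest n A = A ∈ ℋ ⊎ ∃ λ k → n ℕ.≤ k × A ≡ X k

      -- Independence of the sets not yet read makes the next split multiplicative in mean, while
      -- `lower` and `upper` keep `s` bracketed.
      record Invariant (n : ℕ) (σ : ℕ → Side) : Set where
        field
          low⫫       : low ∘ σ ⫫ Rest n
          piv⫫       : piv ∘ σ ⫫ Rest n
          low-cauchy : Cauchy (mean (low ∘ σ))
          piv-cauchy : Cauchy (mean (piv ∘ σ))
          lower      : mean (low ∘ σ) ≾ seq s
          upper      : seq s ≾ mean ((low ∘ σ) ⊕ (piv ∘ σ))

      open Invariant

      Rest-suc : ∀ {n} → Rest (suc n) ⊆ Rest n
      Rest-suc = Sum.map₂ λ { (k , n<k , A≡) → k , ℕ.<⇒≤ n<k , A≡ }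

      X∉Rest : ∀ n → X n ∉ Rest (suc n)
      X∉Rest n (inj₁ Xn∈ℋ) = X∉ℋ n Xn∈ℋ
      X∉Rest n (inj₂ (k , n<k , Xn≡Xk)) = ℕ.<⇒≢ n<k (X-injective Xn≡Xk)

      module _ {n : ℕ} {σ : ℕ → Side} (inv : Invariant n σ) where

        private
          L = low ∘ σ
          V = piv ∘ σ
          VX = V ⊛ 𝟙 (X n)

          Xn∈Rest : X n ∈ Rest n
          Xn∈Rest = inj₂ (n , ℕ.≤-refl , refl)

          mean-VX : mean VX ≋ mean V ⊛ ρ (X n)
          mean-VX = ⫫-mean {f = V} (piv⫫ inv) Xn∈Rest

          VX⫫ : VX ⫫ Rest (suc n)
          VX⫫ = ⫫-* {f = V} (piv⫫ inv) Xn∈Rest Rest-suc (X∉Rest n)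

          VX-cauchy : Cauchy (mean VX)
          VX-cauchy = cauchy-≋ (≋-sym mean-VX)
            (cauchy-* (mean V) (ρ (X n)) (piv-cauchy inv) (ρX-cauchy n))

          L⫫ : L ⫫ Rest (suc n)
          L⫫ = ⫫-⊆ {f = L} Rest-suc (low⫫ inv)

          V⫫ : V ⫫ Rest (suc n)
          V⫫ = ⫫-⊆ {f = V} Rest-suc (piv⫫ inv)

        candidate-cauchy : Cauchy (mean (candidate n σ))
        candidate-cauchy = cauchy-≋ (≋-sym (mean-+ L VX))
          (cauchy-+ (mean L) (mean VX) (low-cauchy inv) VX-cauchy)

        private
          refined : Bool → ℕ → Side
          refined b m = refine b (X n m) (σ m)

          low-true : low ∘ refined true ≡ L ⊕ VX
          low-true = ext λ m → refine-low-true (X n m) (σ m)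

          piv-true : piv ∘ refined true ≡ V ⊖ VX
          piv-true = ext λ m → refine-piv-true (X n m) (σ m)

          low-false : low ∘ refined false ≡ L
          low-false = ext λ m → refine-low-false (X n m) (σ m)

          piv-false : piv ∘ refined false ≡ VX
          piv-false = ext λ m → refine-piv-false (X n m) (σ m)

        invariant-true : mean (candidate n σ) ≾ seq s → Invariant (suc n) (refined true)
        invariant-true c≾s .low⫫ = subst (_⫫ Rest (suc n)) (sym low-true) (⫫-+ {L} {VX} L⫫ VX⫫)
        invariant-true c≾s .piv⫫ = subst (_⫫ Rest (suc n)) (sym piv-true) (⫫-− {V} {VX} V⫫ VX⫫)
        invariant-true c≾s .low-cauchy = subst (Cauchy ∘ mean) (sym low-true) candidate-cauchy
        invariant-true c≾s .piv-cauchy = subst (Cauchy ∘ mean) (sym piv-true)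
          (cauchy-≋ (≋-sym (mean-− V VX)) (cauchy-− (mean V) (mean VX) (piv-cauchy inv) VX-cauchy))
        invariant-true c≾s .lower = subst (λ f → mean f ≾ seq s) (sym low-true) c≾s
        invariant-true c≾s .upper = ≾-trans (upper inv) (proj₁ (mean-cong λ m →
          trans (eq (L m) (V m) (VX m))
            (cong₂ _+_ (sym (refine-low-true (X n m) (σ m))) (sym (refine-piv-true (X n m) (σ m))))))
          where
          eq : ∀ a b c → a + b ≡ (a + c) + (b - c)
          eq = solve-∀ ℚ-ring

        invariant-false : seq s ≾ mean (candidate n σ) → Invariant (suc n) (refined false)
        invariant-false s≾c .low⫫ = subst (_⫫ Rest (suc n)) (sym low-false) L⫫
        invariant-false s≾c .piv⫫ = subst (_⫫ Rest (suc n)) (sym piv-false) VX⫫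
        invariant-false s≾c .low-cauchy = subst (Cauchy ∘ mean) (sym low-false) (low-cauchy inv)
        invariant-false s≾c .piv-cauchy = subst (Cauchy ∘ mean) (sym piv-false) VX-cauchy
        invariant-false s≾c .lower = subst (λ f → mean f ≾ seq s) (sym low-false) (lower inv)
        invariant-false s≾c .upper = ≾-trans s≾c (proj₁ (mean-cong λ m →
          cong₂ _+_ (sym (refine-low-false (X n m) (σ m))) (sym (refine-piv-false (X n m) (σ m)))))

        invariant-refine : Invariant (suc n) (refined (digit n σ))
        invariant-refine = go (digit n σ) refl
          where
          go : ∀ b → digit n σ ≡ b → Invariant (suc n) (refined b)
          go true  e = invariant-true (test⁻ e)
          go false e = invariant-false (≾-total candidate-cauchy (cauchy s)
            λ c≾s → true≢false (trans (sym (test⁺ c≾s)) e))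
            where
            true≢false : true ≢ false
            true≢false ()

        -- The new pivot part is the old one outside or inside `X n`. By independence its mean is
        -- scaled by `1 - ρ (X n)` or `ρ (X n)`, and both are at most `1 - δ`.
        decay : ∀ b → mean (piv ∘ refined b) ≾ mean V ⊖ mean V ⊛ const δ
        decay true = subst (λ f → mean f ≾ mean V ⊖ mean V ⊛ const δ) (sym piv-true)
          (≾-trans (proj₁ (mean-− V VX))
            (≾-− (≾-refl {mean V}) (≾-trans δV≾ (proj₂ mean-VX))))
          where
          δV≾ : mean V ⊛ const δ ≾ mean V ⊛ ρ (X n)
          δV≾ = ≾-*ˡ (unit-mean (unit-piv σ)) (δ≾ρX n)
        decay false = subst (λ f → mean f ≾ mean V ⊖ mean V ⊛ const δ) (sym piv-false)
          (≾-trans (proj₁ mean-VX) (≾-trans (≾-*ˡ (unit-mean (unit-piv σ)) (ρX≾1-δ n))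
            (≤⇒≾ λ m → ℚ.≤-reflexive (eq (mean V m) δ))))
          where
          eq : ∀ a d → a * (1ℚ - d) ≡ a - a * d
          eq = solve-∀ ℚ-ring

      invariant : ∀ n → Invariant n (side n)
      invariant zero = record
        { low⫫       = ⫫-0
        ; piv⫫       = ⫫-1 core₀
        ; low-cauchy = cauchy-≋ (≗⇒≋ λ n → sym (mean-const 0ℚ n)) (cauchy-const 0ℚ)
        ; piv-cauchy = cauchy-≋ (≗⇒≋ λ n → sym (mean-const 1ℚ n)) (cauchy-const 1ℚ)
        ; lower      = ≾-trans (≤⇒≾ λ n → ℚ.≤-reflexive (mean-const 0ℚ n))
                         (<ᴿ⇒≾ {0ᴿ} {s} (proj₁ s∈⟨0,1⟩))
        ; upper      = ≾-trans (<ᴿ⇒≾ {s} {1ᴿ} (proj₂ s∈⟨0,1⟩))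
                         (≤⇒≾ λ n → ℚ.≤-reflexive (sym (mean-const (0ℚ + 1ℚ) n)))
        }
        where
        core₀ : Core P (Rest 0)
        core₀ = core-⊆ (Sum.map₂ λ { (k , _ , A≡) → k , A≡ }) core
      invariant (suc n) = invariant-refine (invariant n)

      δ≤1 : δ ≤ 1ℚ
      δ≤1 = ≾-const (≾-trans (δ≾ρX 0) (≤⇒≾ (proj₂ ∘ unit-ρ (X 0))))

      -- If the pivot mean never fell to `η`, each stage would remove at least `η * δ` from it. This
      -- linear loss already makes it negative after `N` stages.
      piv-small : ∀ η → 0ℚ < η → ∃ λ n → mean (piv ∘ side n) ≾ const η
      piv-small η 0<η = dne λ none →
        let
          large : ∀ n → const η ≾ mean (piv ∘ side n)
          large n = ≾-total (piv-cauchy (invariant n)) (cauchy-const η) (λ h → none (n , h))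
          N , 1<N = archimedean 1ℚ (η * δ) (0<* 0<η 0<δ)
        in none (N , ≾-trans (bound large N)
          (≤⇒≾ λ _ → ℚ.<⇒≤ (ℚ.<-trans (<-by 1<N (eq₂ (ι N * (η * δ)))) 0<η)))
        where
        eq₀ : ∀ a → 1ℚ ≡ 1ℚ - 0ℚ * a
        eq₀ = solve-∀ ℚ-ring
        eq₁ : ∀ n a → (1ℚ - n * a) - a ≡ 1ℚ - (1ℚ + n) * a
        eq₁ = solve-∀ ℚ-ring
        eq₂ : ∀ a → a - 1ℚ ≡ 0ℚ - (1ℚ - a)
        eq₂ = solve-∀ ℚ-ring
        bound : (∀ n → const η ≾ mean (piv ∘ side n)) →
          ∀ n → mean (piv ∘ side n) ≾ const (1ℚ - ι n * (η * δ))
        bound large zero = ≤⇒≾ λ m → subst (mean (piv ∘ side 0) m ≤_) (eq₀ (η * δ))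
          (proj₂ (unit-mean (unit-piv (side 0)) m))
        bound large (suc n) = ≾-trans (decay (invariant n) (digit n (side n)))
          (≾-trans (≾-− (bound large n) (≾-* (λ _ → ℚ.<⇒≤ 0<δ , δ≤1) (large n)))
          (≤⇒≾ λ m → ℚ.≤-reflexive (trans (eq₁ (ι n) (η * δ))
            (cong (λ a → 1ℚ - a * (η * δ)) (sym (ι-suc n))))))

      private
        Y = threshold

        low≾ρY : ∀ n → mean (low ∘ side n) ≾ ρ Y
        low≾ρY n = ≤⇒≾ (mean-mono (low≤threshold n))

        ρY≾low+piv : ∀ n → ρ Y ≾ mean ((low ∘ side n) ⊕ (piv ∘ side n))
        ρY≾low+piv n = ≤⇒≾ (mean-mono (threshold≤low+piv n))

        low+piv≾ : ∀ n {η} → mean (piv ∘ side n) ≾ const η →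
          mean ((low ∘ side n) ⊕ (piv ∘ side n)) ≾ mean (low ∘ side n) ⊕ const η
        low+piv≾ n h = ≾-trans (proj₁ (mean-+ (low ∘ side n) (piv ∘ side n)))
          (≾-+ (≾-refl {mean (low ∘ side n)}) h)

      -- Both sides lie between the means of `low` and of `low` plus `piv` at every stage, and the
      -- gap tends to zero.
      ρ-threshold : ρ threshold ≋ seq s
      ρ-threshold = (≾-slack λ η 0<η →
          let n , h = piv-small η 0<η
          in ≾-trans (ρY≾low+piv n) (≾-trans (low+piv≾ n h) (≾-+ (lower (invariant n)) ≾-refl)))
        , (≾-slack λ η 0<η →
          let n , h = piv-small η 0<η
          in ≾-trans (upper (invariant n)) (≾-trans (low+piv≾ n h) (≾-+ (low≾ρY n) ≾-refl)))

      -- At each stage the indicator is squeezed between two functions independent of `ℋ`, a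
      -- relation preserved under multiplication by `𝟙 (⋂ F)`. Their means differ by at most any
      -- prescribed `η`.
      threshold⫫ : 𝟙 threshold ⫫ ℋ
      threshold⫫ F dF allF = (≾-slack λ η 0<η →
          let n , h = piv-small η 0<η
              L = low ∘ side n
              V = piv ∘ side n
          in ≾-trans (≤⇒≾ (mean-mono λ m → *-monoˡ (D m) (0≤D m) (threshold≤low+piv n m)))
            (≾-trans (proj₁ (⫫-+ {L} {V} (low⫫ (invariant n)) (piv⫫ (invariant n)) F dF (All-rest allF)))
            (≾-trans (≾-* (unit-∏ρ F) (≾-trans (low+piv≾ n h) (≾-+ (low≾ρY n) (≾-refl {const η}))))
            (slack η 0<η (ρ Y)))))
        , (≾-slack λ η 0<η →
          let n , h = piv-small η 0<η
              L = low ∘ side n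
          in ≾-trans (≾-* (unit-∏ρ F) (≾-trans (ρY≾low+piv n) (low+piv≾ n h)))
            (≾-trans (slack η 0<η (mean L))
            (≾-+ (≾-trans (proj₂ (low⫫ (invariant n) F dF (All-rest allF)))
              (≤⇒≾ (mean-mono λ m → *-monoˡ (D m) (0≤D m) (low≤threshold n m)))) (≾-refl {const η}))))
        where
        D = 𝟙 (⋂ F)
        0≤D : ∀ m → 0ℚ ≤ D m
        0≤D m = proj₁ (unit-𝟙 (⋂ F) m)
        All-rest : ∀ {n G} → All ℋ G → All (Rest n) G
        All-rest = All.map inj₁
        -- The product of frequencies is at most `1`, so the error survives multiplication by it.
        slack : ∀ η → 0ℚ < η → ∀ u → (u ⊕ const η) ⊛ ∏ρ F ≾ u ⊛ ∏ρ F ⊕ const η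
        slack η 0<η u = ≤⇒≾ λ m →
          ≤-by (*-monoˡ η (ℚ.<⇒≤ 0<η) (proj₂ (unit-∏ρ F m))) (eq (u m) η (∏ρ F m))
          where
          eq : ∀ u η p → 1ℚ * η - p * η ≡ (u * p + η) - (u + η) * p
          eq = solve-∀ ℚ-ring

-- Walsh sets

-- The number `2 ^ m * (2 * n + 1)`.
pair : ℕ → ℕ → ℕ
pair zero    n = suc (2 ℕ.* n)
pair (suc m) n = 2 ℕ.* pair m n

pair-injective : ∀ m n m′ n′ → pair m n ≡ pair m′ n′ → m ≡ m′ × n ≡ n′
pair-injective zero n zero n′ e = refl , ℕ.*-cancelˡ-≡ n n′ 2 (ℕ.suc-injective e)
pair-injective zero n (suc m′) n′ e = ⊥-elim (ℕ.even≢odd (pair m′ n′) n (sym e))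
pair-injective (suc m) n zero n′ e = ⊥-elim (ℕ.even≢odd (pair m n) n′ e)
pair-injective (suc m) n (suc m′) n′ e =
  let p , q = pair-injective m n m′ n′ (ℕ.*-cancelˡ-≡ (pair m n) (pair m′ n′) 2 e)
  in cong suc p , q

-- Leading zeros are lost, so the value encodes a node of the binary tree only together with its
-- depth `k`.
prefix : (ℕ → Bool) → ℕ → ℕ
prefix x zero    = 0
prefix x (suc k) = if x k then suc (2 ℕ.* prefix x k) else 2 ℕ.* prefix x k

prefix-agree : ∀ x y k → prefix x k ≡ prefix y k → ∀ i → i ℕ.< k → x i ≡ y i
prefix-agree x y (suc k) e i i<1+k = [ prefix-agree x y k below i , (λ { refl → last }) ]′
  (ℕ.m≤n⇒m<n∨m≡n (ℕ.s≤s⁻¹ i<1+k))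
  where
  step : ∀ a b m n →
    (if a then suc (2 ℕ.* m) else 2 ℕ.* m) ≡ (if b then suc (2 ℕ.* n) else 2 ℕ.* n) →
    a ≡ b × m ≡ n
  step true  true  m n e = refl , ℕ.*-cancelˡ-≡ m n 2 (ℕ.suc-injective e)
  step false false m n e = refl , ℕ.*-cancelˡ-≡ m n 2 e
  step true  false m n e = ⊥-elim (ℕ.even≢odd n m (sym e))
  step false true  m n e = ⊥-elim (ℕ.even≢odd m n e)
  last : x k ≡ y k
  last = proj₁ (step (x k) (y k) (prefix x k) (prefix y k) e)
  below : prefix x k ≡ prefix y k
  below = proj₂ (step (x k) (y k) (prefix x k) (prefix y k) e)

-- Symmetric i f and Antisymmetric i f say how f behaves when the i-th
-- bijective binary digit of its argument is flipped.
Symmetric Antisymmetric : ℕ → (ℕᵇ → Bool) → Set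
Symmetric zero    f = ∀ x → f 2[1+ x ] ≡ f 1+[2 x ]
Symmetric (suc i) f = Symmetric i (f ∘ 1+[2_]) × Symmetric i (f ∘ 2[1+_])
Antisymmetric zero    f = ∀ x → f 2[1+ x ] ≡ not (f 1+[2 x ])
Antisymmetric (suc i) f = Antisymmetric i (f ∘ 1+[2_]) × Antisymmetric i (f ∘ 2[1+_])

symmetric-const : ∀ i b → Symmetric i (const b)
symmetric-const zero    b = λ _ → refl
symmetric-const (suc i) b = symmetric-const i b , symmetric-const i b

symmetric-∧ : ∀ i {f g} → Symmetric i f → Symmetric i g → Symmetric i (λ x → f x ∧ g x)
symmetric-∧ zero    p q = λ x → cong₂ _∧_ (p x) (q x)
symmetric-∧ (suc i) (p , p′) (q , q′) = symmetric-∧ i p q , symmetric-∧ i p′ q′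

symmetric-antisymmetric : ∀ i {f} → Symmetric i f → ¬ Antisymmetric i f
symmetric-antisymmetric zero {f} p q = Bool.not-¬ (p zero) (q zero)
symmetric-antisymmetric (suc i) (p , _) (q , _) = symmetric-antisymmetric i p q

-- Flipping digit `i` changes the sign of `h`; arguments with too few digits are unconstrained.
Cancelling : ℕ → (ℕᵇ → ℚ) → Set
Cancelling zero    h = ∀ x → h 1+[2 x ] + h 2[1+ x ] ≡ 0ℚ
Cancelling (suc i) h = Cancelling i (h ∘ 1+[2_]) × Cancelling i (h ∘ 2[1+_])

fromℕ-odd : ∀ n → fromℕ (1 ℕ.+ 2 ℕ.* n) ≡ 1+[2 fromℕ n ]
fromℕ-odd n = trans (cong (λ k → fromℕ (1 ℕ.+ 2 ℕ.* k)) (sym (toℕ-fromℕ n)))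
  (fromℕ-toℕ 1+[2 fromℕ n ])

fromℕ-even : ∀ n → fromℕ (2 ℕ.* suc n) ≡ 2[1+ fromℕ n ]
fromℕ-even n = trans (cong (λ k → fromℕ (2 ℕ.* suc k)) (sym (toℕ-fromℕ n)))
  (fromℕ-toℕ 2[1+ fromℕ n ])

partialᵇ : (ℕᵇ → ℚ) → ℕ → ℚ
partialᵇ h = partial (h ∘ fromℕ)

-- Below `1 + 2 * n` lie zero, `n` odd numbers and `n` positive even numbers, so the two halves have
-- equal length and can cancel termwise.
sum-odd : ∀ h n →
  partialᵇ h (1 ℕ.+ 2 ℕ.* n) ≡ h zero + (partialᵇ (h ∘ 1+[2_]) n + partialᵇ (h ∘ 2[1+_]) n)
sum-odd h zero    = cong (h zero +_) (sym (ℚ.+-identityʳ 0ℚ))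
sum-odd h (suc n) = trans (cong (λ k → partialᵇ h (1 ℕ.+ k)) (ℕ.*-suc 2 n))
  (trans (cong₂ (λ a b → h a + (h b + partialᵇ h (1 ℕ.+ 2 ℕ.* n)))
      (trans (cong fromℕ (sym (ℕ.*-suc 2 n))) (fromℕ-even n)) (fromℕ-odd n))
  (trans (cong (λ s → h 2[1+ fromℕ n ] + (h 1+[2 fromℕ n ] + s)) (sum-odd h n))
  (eq (h 2[1+ fromℕ n ]) (h 1+[2 fromℕ n ]) (h zero)
    (partialᵇ (h ∘ 1+[2_]) n) (partialᵇ (h ∘ 2[1+_]) n))))
  where
  eq : ∀ a b c d e → a + (b + (c + (d + e))) ≡ c + ((b + d) + (a + e))
  eq = solve-∀ ℚ-ring

sum-even : ∀ h n → partialᵇ h (2 ℕ.* suc n) ≡ h 1+[2 fromℕ n ] + partialᵇ h (1 ℕ.+ 2 ℕ.* n)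
sum-even h n = trans (cong (partialᵇ h) (ℕ.*-suc 2 n))
  (cong (λ a → h a + partialᵇ h (1 ℕ.+ 2 ℕ.* n)) (fromℕ-odd n))

∣+∣≤ : ∀ p q {a b} → ∣ p ∣ ≤ a → ∣ q ∣ ≤ b → ∣ p + q ∣ ≤ a + b
∣+∣≤ p q p≤a q≤b = ℚ.≤-trans (ℚ.∣p+q∣≤∣p∣+∣q∣ p q) (ℚ.+-mono-≤ p≤a q≤b)

-- Induction on `i`. At odd lengths the two halves cancel exactly or are bounded by induction, say
-- by `K`; the value at zero and a possible last unpaired term add at most `1` each.
cancelling⇒boundedSums : ∀ i h → (∀ x → ∣ h x ∣ ≤ 1ℚ) → Cancelling i h → BoundedSums (h ∘ fromℕ)
cancelling⇒boundedSums i h h≤1 can = 1ℚ + (1ℚ + K) , 0≤K′ , λ n →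
  subst (λ k → ∣ partialᵇ h k ∣ ≤ 1ℚ + (1ℚ + K)) (toℕ-fromℕ n) (bound (fromℕ n))
  where
  halves : ∀ i → Cancelling i h → ∃ λ K → 0ℚ ≤ K ×
    ∀ n → ∣ partialᵇ (h ∘ 1+[2_]) n + partialᵇ (h ∘ 2[1+_]) n ∣ ≤ K
  halves zero can = 0ℚ , ℚ.≤-refl , λ n → ℚ.≤-reflexive (cong ∣_∣
    (trans (sym (partial-+ (h ∘ 1+[2_] ∘ fromℕ) (h ∘ 2[1+_] ∘ fromℕ) n))
    (trans (partial-cong (can ∘ fromℕ) n) (trans (partial-const 0ℚ n) (ℚ.*-zeroʳ (ι n))))))
  halves (suc i) (can₁ , can₂) =
    let K₁ , 0≤K₁ , b₁ = cancelling⇒boundedSums i (h ∘ 1+[2_]) (h≤1 ∘ 1+[2_]) can₁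
        K₂ , 0≤K₂ , b₂ = cancelling⇒boundedSums i (h ∘ 2[1+_]) (h≤1 ∘ 2[1+_]) can₂
    in K₁ + K₂ , subst (_≤ K₁ + K₂) (ℚ.+-identityˡ 0ℚ) (ℚ.+-mono-≤ 0≤K₁ 0≤K₂) ,
       λ n → ∣+∣≤ (partialᵇ (h ∘ 1+[2_]) n) (partialᵇ (h ∘ 2[1+_]) n) (b₁ n) (b₂ n)
  K = proj₁ (halves i can)
  0≤K′ : 0ℚ ≤ 1ℚ + (1ℚ + K)
  0≤K′ = ℚ.+-mono-≤ (ℚ.<⇒≤ 0<1) (ℚ.+-mono-≤ (ℚ.<⇒≤ 0<1) (proj₁ (proj₂ (halves i can))))
  odd : ∀ n → ∣ partialᵇ h (1 ℕ.+ 2 ℕ.* n) ∣ ≤ 1ℚ + K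
  odd n = subst (λ a → ∣ a ∣ ≤ 1ℚ + K) (sym (sum-odd h n))
    (∣+∣≤ (h zero) (partialᵇ (h ∘ 1+[2_]) n + partialᵇ (h ∘ 2[1+_]) n)
      (h≤1 zero) (proj₂ (proj₂ (halves i can)) n))
  bound : ∀ x → ∣ partialᵇ h (ℕᵇ.toℕ x) ∣ ≤ 1ℚ + (1ℚ + K)
  bound zero     = 0≤K′
  bound 1+[2 x ] = ℚ.≤-trans (odd (ℕᵇ.toℕ x))
    (≤-by (ℚ.<⇒≤ 0<1) (eq K))
    where
    eq : ∀ k → 1ℚ - 0ℚ ≡ (1ℚ + (1ℚ + k)) - (1ℚ + k)
    eq = solve-∀ ℚ-ring
  bound 2[1+ x ] = subst (λ a → ∣ a ∣ ≤ 1ℚ + (1ℚ + K)) (sym (sum-even h (ℕᵇ.toℕ x)))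
    (∣+∣≤ (h 1+[2 fromℕ (ℕᵇ.toℕ x) ]) (partialᵇ h (1 ℕ.+ 2 ℕ.* ℕᵇ.toℕ x)) (h≤1 _) (odd (ℕᵇ.toℕ x)))

-- The indicator of `b` centred at its expected density `½` and restricted to `d`.
bias : Bool → Bool → ℚ
bias b d = (bit b - ½) * bit d

∣bias∣≤1 : ∀ b d → ∣ bias b d ∣ ≤ 1ℚ
∣bias∣≤1 true  true  = ℚ.≤ᵇ⇒≤ _
∣bias∣≤1 true  false = ℚ.≤ᵇ⇒≤ _
∣bias∣≤1 false true  = ℚ.≤ᵇ⇒≤ _
∣bias∣≤1 false false = ℚ.≤ᵇ⇒≤ _

bias-cancels : ∀ b d → bias b d + bias (not b) d ≡ 0ℚ
bias-cancels true  true  = refl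
bias-cancels true  false = refl
bias-cancels false true  = refl
bias-cancels false false = refl

bias-cancelling : ∀ i {f g} → Antisymmetric i f → Symmetric i g →
  Cancelling i (λ x → bias (f x) (g x))
bias-cancelling zero {f} {g} p q x = trans
  (cong₂ (λ b d → bias (f 1+[2 x ]) (g 1+[2 x ]) + bias b d) (p x) (q x))
  (bias-cancels (f 1+[2 x ]) (g 1+[2 x ]))
bias-cancelling (suc i) (p , p′) (q , q′) = bias-cancelling i p q , bias-cancelling i p′ q′

-- Flipping digit `i` preserves `g` and complements `f`, so the centred part of `f` on `g` has
-- bounded sums and vanishing mean.
mean-antisymmetric : ∀ i {f g} → Antisymmetric i f → Symmetric i g →
  mean (𝟙 (f ∘ fromℕ) ⊛ 𝟙 (g ∘ fromℕ)) ≋ const ½ ⊛ ρ (g ∘ fromℕ)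
mean-antisymmetric i {f} {g} p q =
  ≋-trans (mean-cong λ n → eq (𝟙 A n) (𝟙 D n))
  (≋-trans (mean-+ H (const ½ ⊛ 𝟙 D))
  (≋-trans (≋-+ (boundedSums⇒mean≋0 {H}
      (cancelling⇒boundedSums i (λ x → bias (f x) (g x)) (λ x → ∣bias∣≤1 (f x) (g x))
        (bias-cancelling i p q)))
    (mean-*ˡ ½ (𝟙 D)))
  (≗⇒≋ λ n → ℚ.+-identityˡ (½ * ρ D n))))
  where
  A = f ∘ fromℕ
  D = g ∘ fromℕ
  H : Seq
  H n = bias (A n) (D n)
  eq : ∀ a d → a * d ≡ (a - ½) * d + ½ * d
  eq = solve-∀ ℚ-ring

-- The digits of bijective numeration are `1` and `2`, so only `1+[2_]` can change the parity
-- accumulated in `b`.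
parity : Bool → (ℕ → Bool) → ℕᵇ → Bool
parity b mask zero     = b
parity b mask 1+[2 x ] = parity (b xor mask 0) (mask ∘ suc) x
parity b mask 2[1+ x ] = parity b (mask ∘ suc) x

parity-not : ∀ b mask x → parity (not b) mask x ≡ not (parity b mask x)
parity-not b mask zero     = refl
parity-not b mask 1+[2 x ] = trans
  (cong (λ c → parity c (mask ∘ suc) x) (sym (Bool.not-distribˡ-xor b (mask 0))))
  (parity-not (b xor mask 0) (mask ∘ suc) x)
parity-not b mask 2[1+ x ] = parity-not b (mask ∘ suc) x

parity-symmetric : ∀ i b mask → mask i ≡ false → Symmetric i (parity b mask)
parity-symmetric zero b mask e x = cong (λ c → parity c (mask ∘ suc) x)
  (sym (trans (cong (b xor_) e) (Bool.xor-identityʳ b)))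
parity-symmetric (suc i) b mask e =
  parity-symmetric i (b xor mask 0) (mask ∘ suc) e , parity-symmetric i b (mask ∘ suc) e

parity-antisymmetric : ∀ i b mask → mask i ≡ true → Antisymmetric i (parity b mask)
parity-antisymmetric zero b mask e x = trans (sym (Bool.not-involutive _)) (cong not (sym (trans
  (cong (λ c → parity c (mask ∘ suc) x) (trans (cong (b xor_) e) (Bool.xor-comm b true)))
  (parity-not b (mask ∘ suc) x))))
parity-antisymmetric (suc i) b mask e =
  parity-antisymmetric i (b xor mask 0) (mask ∘ suc) e , parity-antisymmetric i b (mask ∘ suc) e

0<½ : 0ℚ < ½
0<½ = ℚ.positive⁻¹ ½

module Walsh (em : ExcludedMiddle 0ℓ) (ext : Extensionality 0ℓ 0ℓ) where

  open Logic em
  open Threshold em ext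

  node : ℕ → (ℕ → Bool) → ℕ → ℕ
  node j x k = pair j (pair k (prefix x k))

  Index : Set
  Index = (ℕ → Bool) × ℕ

  -- The branch of the binary tree along x, in the j-th copy of the tree.
  mask : Index → ℕ → Bool
  mask (x , j) i = test (∃ λ k → i ≡ node j x k)

  walsh : Index → Subset
  walsh z = parity false (mask z) ∘ fromℕ

  -- Different copies of the tree share no nodes. Within one copy, a node deeper than a position
  -- where the branches differ lies on only one of them.
  masks-separate : ∀ {x j z} → z ≢ (x , j) → Ev λ k → mask z (node j x k) ≡ false
  masks-separate {x} {j} {y , j′} z≢ = let K , h = almost-disjoint in
    K , λ k K≤k → ¬true⇒false (λ t → h k K≤k (test⁻ t))
    where
    ¬true⇒false : ∀ {b} → b ≢ true → b ≡ false
    ¬true⇒false {true}  h = ⊥-elim (h refl)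
    ¬true⇒false {false} h = refl
    almost-disjoint : Ev λ k → ¬ ∃ λ k′ → node j x k ≡ node j′ y k′
    almost-disjoint with decide (j′ ≡ j)
    ... | inj₂ j′≢j = 0 , λ k _ (k′ , e) →
      j′≢j (sym (proj₁ (pair-injective j (pair k (prefix x k)) j′ (pair k′ (prefix y k′)) e)))
    ... | inj₁ refl =
      let i , y≢x = ¬∀⇒∃¬ {B = λ i → y i ≡ x i} λ y≗x → z≢ (cong (_, j) (ext y≗x))
      in suc i , λ k i<k (k′ , e) → y≢x (agree k k′ i i<k
           (proj₂ (pair-injective j (pair k (prefix x k)) j (pair k′ (prefix y k′)) e)))
      where
      agree : ∀ k k′ i → i ℕ.< k → pair k (prefix x k) ≡ pair k′ (prefix y k′) → y i ≡ x i
      agree k k′ i i<k e with pair-injective k (prefix x k) k′ (prefix y k′) e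
      ... | refl , e′ = sym (prefix-agree x y k e′ i i<k)

  mask-node : ∀ x j k → mask (x , j) (node j x k) ≡ true
  mask-node x j k = test⁺ (k , refl)

  -- At a node on the second branch alone, one set is symmetric and the other antisymmetric, which
  -- excludes equality.
  walsh-injective : ∀ {z z′} → walsh z ≡ walsh z′ → z ≡ z′
  walsh-injective {z} {x , j} e = dne λ z≢ →
    let k , masked = ev-witness (masks-separate z≢)
        i = node j x k
    in symmetric-antisymmetric i
         (parity-symmetric i false (mask z) masked)
         (subst (Antisymmetric i)
           (ext λ b → trans (cong (parity false (mask (x , j))) (sym (fromℕ-toℕ b)))
             (trans (sym (cong (λ A → A (ℕᵇ.toℕ b)) e)) (cong (parity false (mask z)) (fromℕ-toℕ b))))
           (parity-antisymmetric i false (mask (x , j)) (mask-node x j k)))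

  IsWalsh : Family
  IsWalsh A = ∃ λ z → A ≡ walsh z

  -- Each of finitely many other branches avoids all sufficiently deep nodes of the given one, so a
  -- single deep node avoids them all.
  separated : ∀ {x j} F → All (λ A → ∃ λ z → A ≡ walsh z × z ≢ (x , j)) F →
    Ev λ k → ∃ λ g → Symmetric (node j x k) g × ⋂ F ≡ g ∘ fromℕ
  separated [] [] = ev-all λ k → const true , symmetric-const _ true , refl
  separated (A ∷ F) ((z , refl , z≢) ∷ rest) = ev-map₂
    (λ { k masked (g , sym-g , e) → (λ b → parity false (mask z) b ∧ g b) ,
         symmetric-∧ _ (parity-symmetric _ false (mask z) masked) sym-g ,
         cong (λ D n → walsh z n ∧ D n) e })
    (masks-separate z≢) (separated F rest)

  walsh-halves : ∀ z F → All (λ A → ∃ λ z′ → A ≡ walsh z′ × z′ ≢ z) F →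
    ρ (⋂ (walsh z ∷ F)) ≋ const ½ ⊛ ρ (⋂ F)
  walsh-halves z@(x , j) F others =
    let k , g , sym-g , e = ev-witness (separated F others)
        i = node j x k
    in ≋-trans (mean-cong λ n → bit-∧ (walsh z n) (⋂ F n))
         (subst (λ D → mean (𝟙 (walsh z) ⊛ 𝟙 D) ≋ const ½ ⊛ ρ D) (sym e)
           (mean-antisymmetric i (parity-antisymmetric i false (mask z) (mask-node x j k)) sym-g))

  ρ-walsh : ∀ z → ρ (walsh z) ≋ const ½
  ρ-walsh z = ≋-trans (mean-cong λ n → cong bit (sym (Bool.∧-identityʳ (walsh z n))))
    (≋-trans (walsh-halves z [] []) (≗⇒≋ λ n →
      trans (cong (½ *_) (mean-const 1ℚ n)) (ℚ.*-identityʳ ½)))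

  walsh-cauchy : ∀ z → Cauchy (ρ (walsh z))
  walsh-cauchy z = cauchy-≋ (≋-sym (ρ-walsh z)) (cauchy-const ½)

  walsh-core : Core IsProper IsWalsh
  walsh-core F allF = All.map (λ { (z , refl) → proper z }) allF , λ dF → indep F dF allF
    where
    proper : ∀ z → IsProper (walsh z)
    proper z = walsh-cauchy z , ½ , 0<½ , proj₂ (ρ-walsh z) , proj₁ (ρ-walsh z)
    indep : ∀ F → Distinct F → All IsWalsh F → ρ (⋂ F) ≋ ∏ρ F
    indep [] _ _ = ≗⇒≋ (mean-const 1ℚ)
    indep (_ ∷ F) (z∉F ∷ dF) ((z , refl) ∷ allF) =
      ≋-trans (walsh-halves z F (All.zipWith
        (λ { ((z′ , refl) , z≢z′) → z′ , refl , λ z′≡z → z≢z′ (cong walsh (sym z′≡z)) })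
        (allF , z∉F)))
      (≋-trans (≋-*ˡ {w = const ½} (λ n → ℚ.<⇒≤ 0<½ , ℚ.≤ᵇ⇒≤ _) (indep F dF allF))
        (≋-*ʳ (unit-∏ρ F) (≋-sym (ρ-walsh z))))

  module _ (target : (ℕ → Bool) → ℝ) (target∈⟨0,1⟩ : ∀ x → target x ∈ ⟨0,1⟩) where

    sample : (ℕ → Bool) → Subset
    sample x = threshold (λ j → walsh (x , j)) (target x)

    Others : (ℕ → Bool) → List (ℕ → Bool) → Family
    Others x xs A = (∃ λ y → y ∈ˡ xs × A ≡ sample y) ⊎
      ∃₂ λ y j → y ≢ x × y ∉ˡ xs × A ≡ walsh (y , j)

    -- An intermediate stage of a replacement argument: the Walsh sequences with index in `xs` have
    -- given way to their thresholds, the others are intact.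
    Replaced : List (ℕ → Bool) → Family
    Replaced xs A = (∃ λ y → y ∈ˡ xs × A ≡ sample y) ⊎
      ∃₂ λ y j → y ∉ˡ xs × A ≡ walsh (y , j)

    -- Ensures that the sequence to be replaced next is disjoint from the rest of the stage, as the
    -- threshold lemmas require.
    Fresh : List (ℕ → Bool) → Set
    Fresh xs = ∀ x y j → x ∈ˡ xs → y ∉ˡ xs → sample x ≢ walsh (y , j)

    module _ (x : ℕ → Bool) (xs : List (ℕ → Bool))
      (core : Core IsProper (Replaced xs)) (fresh : Fresh xs) (x∉xs : x ∉ˡ xs) where

      private
        X : ℕ → Subset
        X j = walsh (x , j)

        core′ : Core IsProper (λ A → A ∈ Others x xs ⊎ ∃ λ j → A ≡ X j)
        core′ = core-⊆ (λ where
          (inj₁ (inj₁ old))                 → inj₁ old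
          (inj₁ (inj₂ (y , j , _ , y∉ , e))) → inj₂ (y , j , y∉ , e)
          (inj₂ (j , e))                    → inj₂ (x , j , x∉xs , e)) core

        X∉Others : ∀ j → X j ∉ Others x xs
        X∉Others j (inj₁ (y , y∈ , e)) = fresh y x j y∈ x∉xs (sym e)
        X∉Others j (inj₂ (y , i , y≢x , _ , e)) =
          y≢x (sym (cong proj₁ (walsh-injective {x , j} {y , i} e)))

        X-injective : ∀ {i j} → X i ≡ X j → i ≡ j
        X-injective {i} {j} e = cong proj₂ (walsh-injective {x , i} {x , j} e)

      sample⫫ : 𝟙 (sample x) ⫫ Others x xs
      sample⫫ = threshold⫫ X (target x) core′ X-injective X∉Others (λ j → walsh-cauchy (x , j))
        0<½ (λ j → proj₂ (ρ-walsh (x , j))) (λ j → proj₁ (ρ-walsh (x , j))) (target∈⟨0,1⟩ x)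

      ρ-sample′ : ρ (sample x) ≋ seq (target x)
      ρ-sample′ = ρ-threshold X (target x) core′ X-injective X∉Others (λ j → walsh-cauchy (x , j))
        0<½ (λ j → proj₂ (ρ-walsh (x , j))) (λ j → proj₁ (ρ-walsh (x , j))) (target∈⟨0,1⟩ x)

      sample-proper′ : IsProper (sample x)
      sample-proper′ = real-proper {sample x} (target x) (target∈⟨0,1⟩ x) ρ-sample′

      sample∉Others : sample x ∉ Others x xs
      sample∉Others = ⫫⇒∉ sample-proper′ sample⫫

      core-sample : Core IsProper (Others x xs ▹ sample x)
      core-sample = core-▹ (core-⊆ inj₁ core′) sample-proper′ sample⫫

    -- One sequence is replaced at a time. `Fresh` persists because a new sample, being proper and
    -- independent of the remaining sets, is none of them.
    replaced : ∀ xs → Core IsProper (Replaced xs) × Fresh xs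
    replaced [] = core-⊆ (λ { (inj₂ (y , j , _ , e)) → (y , j) , e }) walsh-core , λ _ _ _ ()
    replaced (x ∷ xs) with decide (x ∈ˡ xs)
    ... | inj₁ x∈xs = core-⊆ (Sum.map
            (λ { (y , here refl , e) → y , x∈xs , e ; (y , there y∈ , e) → y , y∈ , e })
            (λ { (y , j , y∉ , e) → y , j , y∉ ∘ there , e })) (proj₁ (replaced xs)) ,
          λ { y z j (here refl) z∉ → proj₂ (replaced xs) y z j x∈xs (z∉ ∘ there)
            ; y z j (there y∈)  z∉ → proj₂ (replaced xs) y z j y∈ (z∉ ∘ there) }
    ... | inj₂ x∉xs = core-⊆ (λ where
            (inj₁ (y , here refl , e)) → inj₂ e
            (inj₁ (y , there y∈ , e))  → inj₁ (inj₁ (y , y∈ , e))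
            (inj₂ (y , j , y∉ , e))    →
              inj₁ (inj₂ (y , j , (λ y≡x → y∉ (here y≡x)) , y∉ ∘ there , e)))
          (core-sample x xs core fresh x∉xs) ,
          λ { y z j (here refl) z∉ e → sample∉Others x xs core fresh x∉xs
                (inj₂ (z , j , (λ z≡x → z∉ (here z≡x)) , z∉ ∘ there , e))
            ; y z j (there y∈) z∉ → fresh y z j y∈ (z∉ ∘ there) }
      where
      core = proj₁ (replaced xs)
      fresh = proj₂ (replaced xs)

    ρ-sample : ∀ x → ρ (sample x) ≋ seq (target x)
    ρ-sample x = ρ-sample′ x [] (proj₁ (replaced [])) (proj₂ (replaced [])) λ ()

    -- Once `y` is replaced, `sample y` belongs to a family of which `sample x` is independent, and
    -- a proper set is never a member of such a family.
    sample-injective : ∀ {x y} → sample x ≡ sample y → x ≡ y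
    sample-injective {x} {y} e = dne λ x≢y →
      sample∉Others x (y ∷ []) (proj₁ (replaced (y ∷ []))) (proj₂ (replaced (y ∷ [])))
        (λ { (here x≡y) → x≢y x≡y }) (inj₁ (y , here refl , e))

    IsSample : Family
    IsSample A = ∃ λ x → A ≡ sample x

    -- A list of samples involves finitely many indices, so it is contained in one stage
    -- `Replaced xs`.
    sample-core : ∀ {P} → (∀ x → P (sample x)) → Core P IsSample
    sample-core Psample F allF =
      All.map (λ { (x , refl) → Psample x }) allF ,
      let xs , allF′ = collect allF
      in λ dF → core-indep (proj₁ (replaced xs)) F dF
        (All.map (λ { (x , x∈ , e) → inj₁ (x , x∈ , e) }) allF′)
      where
      collect : ∀ {F} → All IsSample F → ∃ λ xs → All (λ A → ∃ λ x → x ∈ˡ xs × A ≡ sample x) F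
      collect [] = [] , []
      collect ((x , e) ∷ allF) = let xs , rest = collect allF in
        x ∷ xs , (x , here refl , e) ∷ All.map (λ { (y , y∈ , e′) → y , there y∈ , e′ }) rest

-- Equivalence with d-independence

≋-*-bounded : ∀ {u v u′ v′} → Unit u → Unit v → u ≋ u′ → v ≋ v′ → u ⊛ v ≋ u′ ⊛ v′
≋-*-bounded {u} {v} {u′} {v′} 1u 1v u≋u′ v≋v′ = ∣-∣⇒≋ λ ε 0<ε →
  -- The cap at `1ℚ` bounds the product of the two errors by one of them. The three error terms then
  -- stay below three quarters of `ε`.
  let h = (½ * (½ * ε)) ⊓ 1ℚ
      0<h = 0<⊓ (0<½* (0<½* 0<ε)) 0<1
  in ev-map₂ (λ n a b → close ε 0<ε h (ℚ.p⊓q≤p (½ * (½ * ε)) 1ℚ) (ℚ.p⊓q≤q (½ * (½ * ε)) 1ℚ) n a b)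
    (≋⇒∣-∣ u≋u′ h 0<h) (≋⇒∣-∣ v≋v′ h 0<h)
  where
  ∣*∣≤ : ∀ p q → ∣ p ∣ ≤ 1ℚ → ∣ p * q ∣ ≤ ∣ q ∣
  ∣*∣≤ p q p≤1 = subst₂ _≤_ (sym (ℚ.∣p*q∣≡∣p∣*∣q∣ p q)) (ℚ.*-identityˡ ∣ q ∣)
    (*-monoˡ ∣ q ∣ (ℚ.0≤∣p∣ q) p≤1)
  ∣unit∣ : ∀ {w} → Unit w → ∀ n → ∣ w n ∣ ≤ 1ℚ
  ∣unit∣ 1w n = subst (_≤ 1ℚ) (sym (ℚ.0≤p⇒∣p∣≡p (proj₁ (1w n)))) (proj₂ (1w n))
  close : ∀ ε → 0ℚ < ε → ∀ h → h ≤ ½ * (½ * ε) → h ≤ 1ℚ → ∀ n →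
    ∣ u n - u′ n ∣ < h → ∣ v n - v′ n ∣ < h → ∣ u n * v n - u′ n * v′ n ∣ < ε
  close ε 0<ε h h≤ h≤1 n u-u′ v-v′ = subst (λ a → ∣ a ∣ < ε) (sym (eq (u n) (v n) (u′ n) (v′ n)))
    (ℚ.≤-<-trans (∣+∣≤ (u n * b + v n * a) (- a * b)
        (∣+∣≤ (u n * b) (v n * a) (∣*∣≤ (u n) b (∣unit∣ 1u n)) (∣*∣≤ (v n) a (∣unit∣ 1v n)))
        (∣*∣≤ (- a) b (subst (_≤ 1ℚ) (sym (ℚ.∣-p∣≡∣p∣ a)) (ℚ.≤-trans (ℚ.<⇒≤ u-u′) h≤1))))
      (<-by (ℚ.+-mono-<-≤ (ℚ.+-mono-< (ℚ.+-mono-< (ℚ.+-mono-< v-v′ u-u′) v-v′) (0<½* (0<½* 0<ε)))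
          (ℚ.+-mono-≤ (ℚ.+-mono-≤ h≤ h≤) h≤)) (eq′ ∣ a ∣ ∣ b ∣ h ε)))
    where
    a = u n - u′ n
    b = v n - v′ n
    eq : ∀ u v u′ v′ → u * v - u′ * v′ ≡ u * (v - v′) + v * (u - u′) + - (u - u′) * (v - v′)
    eq = solve-∀ ℚ-ring
    eq′ : ∀ a b h ε → ((h + h + h + ½ * (½ * ε)) + (½ * (½ * ε) + ½ * (½ * ε) + ½ * (½ * ε)))
      - ((b + a + b + 0ℚ) + (h + h + h)) ≡ ε - (b + a + b)
    eq′ = solve-∀ ℚ-ring

∏ρ-product : ∀ {F xs} → Pointwise HasDensity F xs → ∏ρ F ≋ seq (product xs)
∏ρ-product [] = ≋-refl
∏ρ-product {A ∷ F} {x ∷ xs} (d ∷ ds) =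
  ≋-*-bounded (unit-ρ A) (unit-∏ρ F) (hasDensity⇒≋ {A} {x} d) (∏ρ-product ds)

hasDensity-ρ : ∀ {A} (c : Cauchy (ρ A)) → HasDensity A (mkℝ (ρ A) c)
hasDensity-ρ {A} c = ≋⇒hasDensity {A} {mkℝ (ρ A) c} ≋-refl

cauchy-∏ρ : ∀ F → All (Cauchy ∘ ρ) F → Cauchy (∏ρ F)
cauchy-∏ρ []      []       = cauchy-const 1ℚ
cauchy-∏ρ (A ∷ F) (c ∷ cs) = cauchy-* (ρ A) (∏ρ F) c (cauchy-∏ρ F cs)

∈⇒⋂-absorbs : ∀ {A F} → A ∈ˡ F → ∀ n → A n ∧ ⋂ F n ≡ ⋂ F n
∈⇒⋂-absorbs {A} {_ ∷ F} (here refl) n = trans (sym (Bool.∧-assoc (A n) (A n) (⋂ F n)))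
  (cong (_∧ ⋂ F n) (Bool.∧-idem (A n)))
∈⇒⋂-absorbs {A} {B ∷ F} (there A∈F) n = trans (sym (Bool.∧-assoc (A n) (B n) (⋂ F n)))
  (trans (cong (_∧ ⋂ F n) (Bool.∧-comm (A n) (B n)))
  (trans (Bool.∧-assoc (B n) (A n) (⋂ F n)) (cong (B n ∧_) (∈⇒⋂-absorbs A∈F n))))

⋂-++ : ∀ F G n → ⋂ (F ++ G) n ≡ ⋂ F n ∧ ⋂ G n
⋂-++ []      G n = refl
⋂-++ (A ∷ F) G n = trans (cong (A n ∧_) (⋂-++ F G n)) (sym (Bool.∧-assoc (A n) (⋂ F n) (⋂ G n)))

module DIndependence (em : ExcludedMiddle 0ℓ) (ext : Extensionality 0ℓ 0ℓ) where

  open Logic em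

  -- The linear span of the indicators of finite intersections; it is an
  -- algebra, so it contains the indicators of all of ⟨ 𝒜 ⟩.
  data Span (𝒜 : Family) : Seq → Set where
    meet : ∀ F → All 𝒜 F → Span 𝒜 (𝟙 (⋂ F))
    plus : ∀ f g → Span 𝒜 f → Span 𝒜 g → Span 𝒜 (f ⊕ g)
    minus : ∀ f g → Span 𝒜 f → Span 𝒜 g → Span 𝒜 (f ⊖ g)

  span-≗ : ∀ {𝒜 f g} → (∀ n → f n ≡ g n) → Span 𝒜 f → Span 𝒜 g
  span-≗ {𝒜} f≗g = subst (Span 𝒜) (ext f≗g)

  span-* : ∀ {𝒜 f g} → Span 𝒜 f → Span 𝒜 g → Span 𝒜 (f ⊛ g)
  span-* (meet F allF) (meet G allG) = span-≗
    (λ n → trans (cong bit (⋂-++ F G n)) (bit-∧ (⋂ F n) (⋂ G n)))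
    (meet (F ++ G) (All.++⁺ allF allG))
  span-* {f = f} s@(meet _ _) (plus g h t u) = span-≗ (λ n → sym (ℚ.*-distribˡ-+ (f n) (g n) (h n)))
    (plus (f ⊛ g) (f ⊛ h) (span-* s t) (span-* s u))
  span-* {f = f} s@(meet _ _) (minus g h t u) = span-≗ (λ n → eq (f n) (g n) (h n))
    (minus (f ⊛ g) (f ⊛ h) (span-* s t) (span-* s u))
    where
    eq : ∀ a b c → a * b - a * c ≡ a * (b - c)
    eq = solve-∀ ℚ-ring
  span-* {g = h} (plus f g s t) u = span-≗ (λ n → sym (ℚ.*-distribʳ-+ (h n) (f n) (g n)))
    (plus (f ⊛ h) (g ⊛ h) (span-* s u) (span-* t u))
  span-* {g = h} (minus f g s t) u = span-≗ (λ n → eq (f n) (g n) (h n))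
    (minus (f ⊛ h) (g ⊛ h) (span-* s u) (span-* t u))
    where
    eq : ∀ a b c → a * c - b * c ≡ (a - b) * c
    eq = solve-∀ ℚ-ring

  ⟨⟩⇒span : ∀ {𝒜 A} → A ∈ ⟨ 𝒜 ⟩ → Span 𝒜 (𝟙 A)
  ⟨⟩⇒span {A = A} (generator A∈𝒜) =
    span-≗ (λ n → cong bit (Bool.∧-identityʳ (A n))) (meet (A ∷ []) (A∈𝒜 ∷ []))
  ⟨⟩⇒span empty = minus (const 1ℚ) (const 1ℚ) (meet [] []) (meet [] [])
  ⟨⟩⇒span (complement {A} p) = span-≗ (λ n → sym (bit-not (A n)))
    (minus (const 1ℚ) (𝟙 A) (meet [] []) (⟨⟩⇒span p))
  ⟨⟩⇒span (union {A} {B} p q) = span-≗ (λ n → sym (bit-∨ (A n) (B n)))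
    (minus (𝟙 A ⊕ 𝟙 B) (𝟙 A ⊛ 𝟙 B) (plus (𝟙 A) (𝟙 B) (⟨⟩⇒span p) (⟨⟩⇒span q))
      (span-* (⟨⟩⇒span p) (⟨⟩⇒span q)))

  -- Products in the span may repeat a set, whereas the product formula concerns distinct lists.
  deduplicate : ∀ {𝒜 : Family} F → All 𝒜 F →
    ∃ λ G → Distinct G × All 𝒜 G × ∀ n → ⋂ F n ≡ ⋂ G n
  deduplicate [] [] = [] , [] , [] , λ _ → refl
  deduplicate (A ∷ F) (A∈𝒜 ∷ allF) with deduplicate F allF
  ... | G , dG , allG , eq with decide (A ∈ˡ G)
  ...   | inj₁ A∈G = G , dG , allG , λ n → trans (cong (A n ∧_) (eq n)) (∈⇒⋂-absorbs A∈G n)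
  ...   | inj₂ A∉G = A ∷ G , All.¬Any⇒All¬ G A∉G ∷ dG , A∈𝒜 ∷ allG , λ n → cong (A n ∧_) (eq n)

  module _ {𝒜 : Family} (core : Core IsProper 𝒜) where

    span-cauchy : ∀ {f} → Span 𝒜 f → Cauchy (mean f)
    span-cauchy (meet F allF) =
      let G , dG , allG , eq = deduplicate F allF
      in cauchy-≋ (≋-trans (≋-sym (core-indep core G dG allG))
           (mean-cong λ n → cong bit (sym (eq n))))
           (cauchy-∏ρ G (All.map (λ A∈𝒜 → proj₁ (core-member core A∈𝒜)) allG))
    span-cauchy (plus f g s t) = cauchy-≋ (≋-sym (mean-+ f g))
      (cauchy-+ (mean f) (mean g) (span-cauchy s) (span-cauchy t))
    span-cauchy (minus f g s t) = cauchy-≋ (≋-sym (mean-− f g))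
      (cauchy-− (mean f) (mean g) (span-cauchy s) (span-cauchy t))

    core⇒isDIndependent : Satisfiable 𝒜 → IsDIndependent 𝒜
    core⇒isDIndependent nonempty =
      nonempty ,
      (λ {A} A∈𝒜 → let c = proj₁ (core-member core A∈𝒜) in mkℝ (ρ A) c , hasDensity-ρ {A} c) ,
      (λ { {x} (A , A∈𝒜 , d) →
        proper-real {A} x (core-member core A∈𝒜) (hasDensity⇒≋ {A} {x} d) }) ,
      (λ {A} A∈ → let c = span-cauchy (⟨⟩⇒span A∈) in mkℝ (ρ A) c , hasDensity-ρ {A} c) ,
      λ A F unique all xs ds → ≋⇒hasDensity {⋂ (A ∷ F)} {product xs} (≋-trans
        (core-indep core (A ∷ F) (AllPairs.map (λ ≉ e → ≉ λ n → cong (λ B → B n) e) unique) all)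
        (∏ρ-product ds))

  isDIndependent⇒core : ∀ {𝒜} → IsDIndependent 𝒜 → Core IsProper 𝒜
  isDIndependent⇒core {𝒜} (_ , 𝒜⊆𝒟 , d⊆ , _ , indep) F allF = All.map proper allF , ρ-⋂ F allF
    where
    proper : 𝒜 ⊆ IsProper
    proper {A} A∈𝒜 = let x , d = 𝒜⊆𝒟 A∈𝒜 in
      real-proper {A} x (d⊆ {x} (A , A∈𝒜 , d)) (hasDensity⇒≋ {A} {x} d)
    densities : ∀ {F} → All 𝒜 F → ∃ λ xs → Pointwise HasDensity F xs
    densities [] = [] , []
    densities (A∈𝒜 ∷ all) = let x , d = 𝒜⊆𝒟 A∈𝒜 ; xs , ds = densities all in x ∷ xs , d ∷ ds
    ρ-⋂ : ∀ F → All 𝒜 F → Distinct F → ρ (⋂ F) ≋ ∏ρ F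
    ρ-⋂ [] _ _ = ≗⇒≋ (mean-const 1ℚ)
    ρ-⋂ (A ∷ F) all dF =
      let xs , ds = densities all
      in ≋-trans (hasDensity⇒≋ {⋂ (A ∷ F)} {product xs}
           (indep A F (AllPairs.map (λ ≢ A≗B → ≢ (ext A≗B)) dF) all xs ds))
         (≋-sym (∏ρ-product ds))

  -- If no list exhausted `Q`, each list would miss a point of `Q`; choosing such a point against
  -- the history of earlier choices yields an injective sequence.
  no-sequence⇒finite : {X : Set} (Q : Pred X 0ℓ) →
    ¬ (∃ λ (u : ℕ → X) → (∀ {m n} → u m ≡ u n → m ≡ n) × ∀ n → Q (u n)) →
    ∃ λ L → ∀ x → Q x → x ∈ˡ L
  no-sequence⇒finite {X} Q none = dne λ infinite →
    let
      fresh : ∀ L → ∃ λ x → Q x × x ∉ˡ L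
      fresh L = let x , ¬h = ¬∀⇒∃¬ λ h → infinite (L , h) ; Qx , x∉L = ¬∀⇒∃¬ ¬h in x , Qx , x∉L
    in none (enumerate fresh)
    where
    enumerate : (∀ L → ∃ λ x → Q x × x ∉ˡ L) →
      ∃ λ (u : ℕ → X) → (∀ {m n} → u m ≡ u n → m ≡ n) × ∀ n → Q (u n)
    enumerate fresh = u , injective , λ n → proj₁ (proj₂ (fresh (history n)))
      where
      history : ℕ → List X
      history zero    = []
      history (suc n) = proj₁ (fresh (history n)) ∷ history n
      u : ℕ → X
      u n = proj₁ (fresh (history n))
      earlier : ∀ {m} n → m ℕ.< n → u m ∈ˡ history n
      earlier (suc n) m<1+n with ℕ.m≤n⇒m<n∨m≡n (ℕ.s≤s⁻¹ m<1+n)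
      ... | inj₁ m<n  = there (earlier n m<n)
      ... | inj₂ refl = here refl
      later : ∀ {m n} → m ℕ.< n → u m ≢ u n
      later {m} {n} m<n e =
        proj₂ (proj₂ (fresh (history n))) (subst (_∈ˡ history n) e (earlier n m<n))
      injective : ∀ {m n} → u m ≡ u n → m ≡ n
      injective {m} {n} e = [ (λ m<n → ⊥-elim (later m<n e)) ,
        [ id , (λ n<m → ⊥-elim (later n<m (sym e))) ]′ ]′ (compare m n)
        where
        compare : ∀ m n → m ℕ.< n ⊎ m ≡ n ⊎ n ℕ.< m
        compare m n with ℕ.≤-total m n
        ... | inj₁ m≤n = [ inj₁ , inj₂ ∘ inj₁ ]′ (ℕ.m≤n⇒m<n∨m≡n m≤n)
        ... | inj₂ n≤m = [ inj₂ ∘ inj₂ , inj₂ ∘ inj₁ ∘ sym ]′ (ℕ.m≤n⇒m<n∨m≡n n≤m)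

-- Coding rationals by natural numbers

codeℤ : ℤ.ℤ → ℕ
codeℤ (ℤ.+ n)    = pair 0 n
codeℤ ℤ.-[1+ n ] = pair 1 n

codeℤ-injective : ∀ i j → codeℤ i ≡ codeℤ j → i ≡ j
codeℤ-injective (ℤ.+ m)    (ℤ.+ n)    e = cong ℤ.+_ (proj₂ (pair-injective 0 m 0 n e))
codeℤ-injective ℤ.-[1+ m ] ℤ.-[1+ n ] e = cong ℤ.-[1+_] (proj₂ (pair-injective 1 m 1 n e))
codeℤ-injective (ℤ.+ m)    ℤ.-[1+ n ] e with pair-injective 0 m 1 n e
... | () , _
codeℤ-injective ℤ.-[1+ m ] (ℤ.+ n)    e with pair-injective 1 m 0 n e
... | () , _

codeℚ : ℚ → ℕ
codeℚ (ℚ.mkℚ i d _) = pair (codeℤ i) d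

codeℚ-injective : ∀ p q → codeℚ p ≡ codeℚ q → p ≡ q
codeℚ-injective (ℚ.mkℚ i d _) (ℚ.mkℚ j e _) eq =
  let eq₁ , eq₂ = pair-injective (codeℤ i) d (codeℤ j) e eq
  in ℚ.mkℚ-cong (codeℤ-injective i j eq₁) eq₂

-- The maximal family

index-injective : ∀ {X : Set} {x y : X} {L} (p : x ∈ˡ L) (q : y ∈ˡ L) →
  toℕ (index p) ≡ toℕ (index q) → x ≡ y
index-injective (here refl) (here refl) _ = refl
index-injective (there p)   (there q)   e = index-injective p q (ℕ.suc-injective e)

Close : Seq → Seq → ℚ → Set
Close u v ε = u ≾ v ⊕ const ε × v ≾ u ⊕ const ε

close-≤ : ∀ {u v δ ε} → δ ≤ ε → Close u v δ → Close u v ε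
close-≤ {u} {v} {δ} {ε} δ≤ε (p , q) = ≾-trans p (widen v) , ≾-trans q (widen u)
  where
  widen : ∀ w → w ⊕ const δ ≾ w ⊕ const ε
  widen w = ≤⇒≾ λ n → ℚ.+-monoʳ-≤ (w n) δ≤ε

close-≋ : ∀ {u u′ v ε} → u ≋ u′ → Close u v ε → Close u′ v ε
close-≋ {ε = ε} (p , p′) (q , q′) = ≾-trans p′ q , ≾-trans q′ (≾-+ p (≾-refl {const ε}))

<ᴿ⇒close : ∀ x y ε → ∣ x -ᴿ y ∣ᴿ <ᴿ fromℚ ε → Close (seq x) (seq y) ε
<ᴿ⇒close x y ε (δ , 0<δ , N , h) =
  mk≾ (λ η 0<η → N , λ n N≤n → widen η 0<η (∣-∣<⇒ˡ (seq x n) (seq y n) (near n N≤n))) ,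
  mk≾ (λ η 0<η → N , λ n N≤n → widen η 0<η (∣-∣<⇒ʳ (seq x n) (seq y n) (near n N≤n)))
  where
  near : ∀ n → N ℕ.≤ n → ∣ seq x n - seq y n ∣ < ε
  near n N≤n = ℚ.<-trans (<-by 0<δ (eq ∣ seq x n - seq y n ∣ δ)) (h n N≤n)
    where
    eq : ∀ a δ → δ - 0ℚ ≡ (a + δ) - a
    eq = solve-∀ ℚ-ring
  widen : ∀ {a b} η → 0ℚ < η → a < b → a < b + η
  widen {a} {b} η 0<η a<b = ℚ.<-trans a<b (<-by 0<η (eq b η))
    where
    eq : ∀ b η → η - 0ℚ ≡ (b + η) - b
    eq = solve-∀ ℚ-ring

close-1- : ∀ {u v δ} → Close u v δ → Close (const 1ℚ ⊖ u) (const 1ℚ ⊖ v) δ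
close-1- {u} {v} {δ} (p , q) = reflect u v q , reflect v u p
  where
  eq₃ : ∀ v δ → 1ℚ - v ≡ (1ℚ + δ) - (v + δ)
  eq₃ = solve-∀ ℚ-ring
  eq₄ : ∀ v δ → (1ℚ + δ) - v ≡ 1ℚ - v + δ
  eq₄ = solve-∀ ℚ-ring
  reflect : ∀ u v → v ≾ u ⊕ const δ → const 1ℚ ⊖ u ≾ (const 1ℚ ⊖ v) ⊕ const δ
  reflect u v h = ≾-trans (≾-trans (≤⇒≾ λ n → ℚ.≤-reflexive (eq₃ (u n) δ))
      (≾-− (≾-refl {const (1ℚ + δ)}) h))
    (≤⇒≾ λ n → ℚ.≤-reflexive (eq₄ (v n) δ))

0<fromℚ : ∀ {ε} → 0ℚ < ε → 0ᴿ <ᴿ fromℚ ε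
0<fromℚ {ε} 0<ε = ½ * ε , 0<½* 0<ε , ev-all λ _ → <-by (0<½* 0<ε) (eq ε)
  where
  eq : ∀ ε → ½ * ε - 0ℚ ≡ ε - (0ℚ + ½ * ε)
  eq = solve-∀ ℚ-ring

module Construction (em : ExcludedMiddle 0ℓ) (ext : Extensionality 0ℓ 0ℓ) where

  open Logic em
  open RealOrder em using (⋠⇒<)
  open Threshold em ext
  open Walsh em ext
  open DIndependence em ext

  apart : ∀ {u v} → ¬ (u ≋ v) → ∃ λ ε → 0ℚ < ε × ¬ Close u v ε
  apart u≋̸v = dne λ none → u≋̸v
    ( ≾-slack (λ ε 0<ε → proj₁ (dne λ ¬close → none (ε , 0<ε , ¬close)))
    , ≾-slack (λ ε 0<ε → proj₂ (dne λ ¬close → none (ε , 0<ε , ¬close))))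

  -- The sign of the limit of `u` is unknown. If it is negative with margin `δ`, no nonnegative `v`
  -- is within half of `δ`; if it is positive, half of `δ` still bounds every close `v` from below.
  away-from-0 : ∀ {u} → Cauchy u → ¬ (u ≋ const 0ℚ) →
    ∃ λ η → 0ℚ < η × ∀ v → const 0ℚ ≾ v → Close v u η → const η ≾ v
  away-from-0 {u} cu u≋̸0 with decide (u ≾ const 0ℚ)
  ... | inj₁ u≾0 =
    let δ , 0<δ , u+δ<0 = ⋠⇒< (cauchy-const 0ℚ) cu λ 0≾u → u≋̸0 (u≾0 , 0≾u)
    in ½ * δ , 0<½* 0<δ , λ v 0≾v (v≾ , _) → ⊥-elim (ℚ.<-irrefl refl
      (ℚ.<-≤-trans (0<½* 0<δ) (≾-const {½ * δ} {0ℚ}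
        (≾-trans (≤⇒≾ λ n → ℚ.≤-reflexive (sym (ℚ.+-identityˡ (½ * δ))))
        (≾-trans (≾-+ (≾-trans 0≾v v≾) (≾-refl {const (½ * δ)}))
        (mk≾ λ ε 0<ε → ev-map (λ n h → <-by (ℚ.+-mono-< h 0<ε) (eq (u n) δ ε)) u+δ<0))))))
    where
    eq : ∀ u δ ε → (0ℚ + ε) - (u + δ + 0ℚ) ≡ (0ℚ + ε) - (u + ½ * δ + ½ * δ)
    eq = solve-∀ ℚ-ring
  ... | inj₂ u⋠0 =
    let δ , 0<δ , δ<u = ⋠⇒< cu (cauchy-const 0ℚ) u⋠0
    in ½ * δ , 0<½* 0<δ , λ v 0≾v (_ , u≾) →
      ≾-trans (mk≾ λ ε 0<ε → ev-map (λ n h → <-by (ℚ.+-mono-< h 0<ε) (eq (u n) δ ε)) δ<u)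
      (≾-trans (≾-− u≾ (≾-refl {const (½ * δ)})) (≤⇒≾ λ n → ℚ.≤-reflexive (eq′ (v n) (½ * δ))))
    where
    eq : ∀ u δ ε → (u + ε) - (0ℚ + δ + 0ℚ) ≡ (u - ½ * δ + ε) - ½ * δ
    eq = solve-∀ ℚ-ring
    eq′ : ∀ v h → (v + h) - h ≡ v
    eq′ = solve-∀ ℚ-ring

  -- The minimum of finitely many positive distances.
  isolated : ∀ u L → ∃ λ ε → 0ℚ < ε × ∀ A → A ∈ˡ L → ¬ (ρ A ≋ u) → ¬ Close (ρ A) u ε
  isolated u [] = 1ℚ , 0<1 , λ _ ()
  isolated u (B ∷ L) = [ old , new ]′ (decide (ρ B ≋ u))
    where
    ε    = proj₁ (isolated u L)
    0<ε  = proj₁ (proj₂ (isolated u L))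
    iso  = proj₂ (proj₂ (isolated u L))
    Isolating : ℚ → Set
    Isolating ε = 0ℚ < ε × ∀ A → A ∈ˡ B ∷ L → ¬ (ρ A ≋ u) → ¬ Close (ρ A) u ε
    old : ρ B ≋ u → ∃ Isolating
    old ρB≋u = ε , 0<ε , λ where
      A (here refl) ≋̸ _     → ≋̸ ρB≋u
      A (there A∈L) ≋̸ close → iso A A∈L ≋̸ close
    new : ¬ (ρ B ≋ u) → ∃ Isolating
    new ρB≋̸u =
      let δ , 0<δ , ¬close = apart ρB≋̸u in
      δ ⊓ ε , 0<⊓ 0<δ 0<ε , λ where
        A (here refl) _ close  → ¬close (close-≤ (ℚ.p⊓q≤p δ ε) close)
        A (there A∈L) ≋̸ close → iso A A∈L ≋̸ (close-≤ (ℚ.p⊓q≤q δ ε) close)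

  -- The graph of `u` as a set of codes, which lets bit sequences index the elements of `S`.
  encode : Seq → ℕ → Bool
  encode u i = test (∃ λ n → i ≡ pair n (codeℚ (u n)))

  encode-injective : ∀ {u v} → encode u ≡ encode v → ∀ n → u n ≡ v n
  encode-injective {u} {v} e n = decode (test⁻ {∃ λ m → pair n (codeℚ (u n)) ≡ pair m (codeℚ (v m))}
    (trans (sym (cong (λ x → x (pair n (codeℚ (u n)))) e))
      (test⁺ {∃ λ m → pair n (codeℚ (u n)) ≡ pair m (codeℚ (u m))} (n , refl))))
    where
    decode : ∃ (λ m → pair n (codeℚ (u n)) ≡ pair m (codeℚ (v m))) → u n ≡ v n
    decode (m , e) = let n≡m , c = pair-injective n (codeℚ (u n)) m (codeℚ (v m)) e in
      trans (codeℚ-injective (u n) (v m) c) (cong v (sym n≡m))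

  module _ (𝒜 : Family) (g : Subset → Subset)
    (g-injective : ∀ {x y} → g x ≡ g y → x ≡ y) (g∈𝒜 : ∀ x → g x ∈ 𝒜) where

    private
      -- The Cantor-Bernstein argument for the inclusion of `𝒜` and the injection `g`: points in the
      -- forward orbit of the complement of `𝒜` are moved by `g`, and all others are fixed.
      data Orbit : Pred Subset 0ℓ where
        start : ∀ {x} → x ∉ 𝒜 → Orbit x
        next  : ∀ {x} → Orbit x → Orbit (g x)

      Split : Subset → Set
      Split x = Orbit x ⊎ ¬ Orbit x

      h : ∀ x → Split x → Σ Subset 𝒜
      h x (inj₁ _) = g x , g∈𝒜 x
      h x (inj₂ ¬o) = x , dne λ x∉𝒜 → ¬o (start x∉𝒜)

      h-injective : ∀ {x y} p q → proj₁ (h x p) ≡ proj₁ (h y q) → x ≡ y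
      h-injective (inj₁ _)  (inj₁ _)  e = g-injective e
      h-injective (inj₁ o)  (inj₂ ¬o) e = ⊥-elim (¬o (subst Orbit e (next o)))
      h-injective (inj₂ ¬o) (inj₁ o)  e = ⊥-elim (¬o (subst Orbit (sym e) (next o)))
      h-injective (inj₂ _)  (inj₂ _)  e = e

      h-orbit : ∀ {x} → Orbit x → ∀ p → proj₁ (h x p) ≡ g x
      h-orbit o (inj₁ _)  = refl
      h-orbit o (inj₂ ¬o) = ⊥-elim (¬o o)

      h-fixed : ∀ {x} → ¬ Orbit x → ∀ p → proj₁ (h x p) ≡ x
      h-fixed ¬o (inj₁ o) = ⊥-elim (¬o o)
      h-fixed ¬o (inj₂ _) = refl

      h-surjective : ∀ y → y ∈ 𝒜 → ∃ λ x → ∀ p → proj₁ (h x p) ≡ y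
      h-surjective y y∈𝒜 with decide (Orbit y)
      ... | inj₁ (start y∉𝒜)  = ⊥-elim (y∉𝒜 y∈𝒜)
      ... | inj₁ (next {x} o) = x , h-orbit o
      ... | inj₂ ¬o           = y , h-fixed ¬o

    injection⇒cardinality𝔠 : HasCardinality𝔠 𝒜
    injection⇒cardinality𝔠 = record
      { to        = to
      ; cong      = λ x≗y n → cong (λ x → proj₁ (to x) n) (ext x≗y)
      ; bijective =
          (λ {x} {y} e n → cong (λ z → z n)
            (h-injective (decide (Orbit x)) (decide (Orbit y)) (ext e))) ,
          λ { (y , y∈𝒜) → let x , hx≡y = h-surjective y y∈𝒜 in
              x , λ {z} z≗x n → trans (cong (λ w → proj₁ (to w) n) (ext z≗x))
                (cong (λ w → w n) (hx≡y (decide (Orbit x)))) }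
      }
      where
      to : Subset → Σ Subset 𝒜
      to x = h x (decide (Orbit x))

  module MaximalFamily (S : Pred ℝ 0ℓ) (S-resp : S Respects _≈ᴿ_)
    (s₀ : ℝ) (s₀∈S : s₀ ∈ S) (S⊆⟨0,1⟩ : S ⊆ ⟨0,1⟩) where

    private
      Coded : (ℕ → Bool) → Set
      Coded x = ∃ λ s → s ∈ S × encode (seq s) ≡ x

      target′ : ∀ {x} → Coded x ⊎ ¬ Coded x → ∃ S
      target′ (inj₁ (s , s∈S , _)) = s , s∈S
      -- Bit sequences that code no element of `S` receive the default `s₀`.
      target′ (inj₂ _)             = s₀ , s₀∈S

      target : (ℕ → Bool) → ℝ
      target x = proj₁ (target′ (decide (Coded x)))

      target∈S : ∀ x → target x ∈ S
      target∈S x = proj₂ (target′ (decide (Coded x)))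

      target-onto : ∀ s → s ∈ S → seq (target (encode (seq s))) ≋ seq s
      target-onto s s∈S = go (decide (Coded (encode (seq s))))
        where
        go : ∀ d → seq (proj₁ (target′ {encode (seq s)} d)) ≋ seq s
        -- The decoded real `r` need not be `s` itself, but equal codes force termwise equal
        -- sequences.
        go (inj₁ (r , _ , e)) = ≗⇒≋ (encode-injective e)
        go (inj₂ ¬c)          = ⊥-elim (¬c (s , s∈S , refl))

      target∈⟨0,1⟩ : ∀ x → target x ∈ ⟨0,1⟩
      target∈⟨0,1⟩ x = S⊆⟨0,1⟩ (target∈S x)

      pick : (ℕ → Bool) → Subset
      pick = sample target target∈⟨0,1⟩

      Picked : Family
      Picked = IsSample target target∈⟨0,1⟩

      InS : Pred Subset 0ℓ
      InS A = ∃ λ s → s ∈ S × ρ A ≋ seq s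

      InS⇒proper : InS ⊆ IsProper
      InS⇒proper {A} (s , s∈S , e) = real-proper {A} s (S⊆⟨0,1⟩ s∈S) e

      picked-core : Core InS Picked
      picked-core = sample-core target target∈⟨0,1⟩
        λ x → target x , target∈S x , ρ-sample target target∈⟨0,1⟩ x

      maximal-InS = Tukey.tukey em ext (Good InS) Picked picked-core

      𝒜₁ : Family
      𝒜₁ A = proj₁ maximal-InS A ≡ true

      picked⊆𝒜₁ : Picked ⊆ 𝒜₁
      picked⊆𝒜₁ = proj₁ (proj₂ maximal-InS)

      𝒜₁-core : Core InS 𝒜₁
      𝒜₁-core = proj₁ (proj₂ (proj₂ maximal-InS))

      𝒜₁-maximal : ∀ Y → Core InS (𝒜₁ ▹ Y) → Y ∈ 𝒜₁
      𝒜₁-maximal = proj₂ (proj₂ (proj₂ maximal-InS))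

      maximal = Tukey.tukey em ext (Good IsProper) 𝒜₁ (core-map (λ {A} → InS⇒proper {A}) 𝒜₁-core)

    𝒜 : Family
    𝒜 A = proj₁ maximal A ≡ true

    ℬ : Family
    ℬ A = A ∈ 𝒜 × A ∉ 𝒜₁

    private
      𝒜₁⊆𝒜 : 𝒜₁ ⊆ 𝒜
      𝒜₁⊆𝒜 = proj₁ (proj₂ maximal)

      𝒜-core : Core IsProper 𝒜
      𝒜-core = proj₁ (proj₂ (proj₂ maximal))

      𝒜-maximal : ∀ Y → Core IsProper (𝒜 ▹ Y) → Y ∈ 𝒜
      𝒜-maximal = proj₂ (proj₂ (proj₂ maximal))

      pick∈𝒜 : ∀ x → pick x ∈ 𝒜
      pick∈𝒜 x = 𝒜₁⊆𝒜 (picked⊆𝒜₁ (x , refl))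

    𝒜-isMaximal : IsMaximalDIndependent 𝒜
    𝒜-isMaximal = core⇒isDIndependent 𝒜-core (pick ω , pick∈𝒜 ω) ,
      λ 𝒞 𝒞-indep 𝒜⊆𝒞 {Y} Y∈𝒞 → 𝒜-maximal Y (core-⊆ (λ where
        (inj₁ A∈𝒜)  → 𝒜⊆𝒞 A∈𝒜
        (inj₂ refl) → Y∈𝒞) (isDIndependent⇒core 𝒞-indep))

    𝒜-cardinality : HasCardinality𝔠 𝒜
    𝒜-cardinality = injection⇒cardinality𝔠 𝒜 pick (sample-injective target target∈⟨0,1⟩) pick∈𝒜

    density-𝒜∖ℬ : d[ 𝒜 ∖ ℬ ] ≐ S
    density-𝒜∖ℬ =
      (λ { {x} (A , (A∈𝒜 , A∉ℬ) , d) →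
        let s , s∈S , ρ≋s = core-member 𝒜₁-core (dne λ A∉𝒜₁ → A∉ℬ (A∈𝒜 , A∉𝒜₁))
        in S-resp {s} {x} (≋⇒∣-∣ (≋-trans (≋-sym ρ≋s) (hasDensity⇒≋ {A} {x} d))) s∈S }) ,
      λ {s} s∈S → let x = encode (seq s) in
        pick x , (pick∈𝒜 x , λ (_ , ∉𝒜₁) → ∉𝒜₁ (picked⊆𝒜₁ (x , refl))) ,
        ≋⇒hasDensity {pick x} {s} (≋-trans (ρ-sample target target∈⟨0,1⟩ x) (target-onto s s∈S))

    private
      Class : ℚ → Family
      Class δ A = A ∈ ℬ × const δ ≾ ρ A × ρ A ≾ const (1ℚ - δ)

      -- Infinitely many members of a class would yield, by thresholding, a new
      -- set of density s₀ that could be added to 𝒜₁.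
      class-finite : ∀ δ → 0ℚ < δ → ∃ λ L → ∀ A → Class δ A → A ∈ˡ L
      class-finite δ 0<δ = no-sequence⇒finite (Class δ) λ (X , X-injective , X∈) →
        let
          s₀∈⟨0,1⟩ = S⊆⟨0,1⟩ s₀∈S
          Y = threshold X s₀
          core : Core IsProper (λ A → A ∈ 𝒜₁ ⊎ ∃ λ n → A ≡ X n)
          core = core-⊆ (λ where
            (inj₁ A∈𝒜₁)      → 𝒜₁⊆𝒜 A∈𝒜₁
            (inj₂ (n , refl)) → proj₁ (proj₁ (X∈ n))) 𝒜-core
          X∉𝒜₁ : ∀ n → X n ∉ 𝒜₁
          X∉𝒜₁ n = proj₂ (proj₁ (X∈ n))
          X-cauchy : ∀ n → Cauchy (ρ (X n))
          X-cauchy n = proj₁ (core-member 𝒜-core (proj₁ (proj₁ (X∈ n))))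
          δ≾ : ∀ n → const δ ≾ ρ (X n)
          δ≾ n = proj₁ (proj₂ (X∈ n))
          ≾1-δ : ∀ n → ρ (X n) ≾ const (1ℚ - δ)
          ≾1-δ n = proj₂ (proj₂ (X∈ n))
          Y⫫ : 𝟙 Y ⫫ 𝒜₁
          Y⫫ = threshold⫫ X s₀ core X-injective X∉𝒜₁ X-cauchy 0<δ δ≾ ≾1-δ s₀∈⟨0,1⟩
          Y∈S : InS Y
          Y∈S = s₀ , s₀∈S , ρ-threshold X s₀ core X-injective X∉𝒜₁ X-cauchy 0<δ δ≾ ≾1-δ s₀∈⟨0,1⟩
        in ⫫⇒∉ (InS⇒proper {Y} Y∈S) Y⫫ (𝒜₁-maximal Y (core-▹ 𝒜₁-core Y∈S Y⫫))

      ℬ-proper : ∀ {A} → A ∈ ℬ → IsProper A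
      ℬ-proper A∈ℬ = core-member 𝒜-core (proj₁ A∈ℬ)

      Classified : Subset → Set
      Classified A = ∃ λ δ → 0ℚ < δ × Class δ A

      classified : ∀ {A} → A ∈ ℬ → Classified A
      classified A∈ℬ = let _ , δ , 0<δ , δ≾ , ≾1-δ = ℬ-proper A∈ℬ in δ , 0<δ , A∈ℬ , δ≾ , ≾1-δ

      position : ∀ δ → 0ℚ < δ → ∀ A → Class δ A → ℕ
      position δ 0<δ A A∈ = toℕ (index (proj₂ (class-finite δ 0<δ) A A∈))

      -- The list enumerating a class depends on the proof of positivity, so equal labels give the
      -- same list only after the two proofs are identified.
      position-injective : ∀ δ η (0<δ : 0ℚ < δ) (0<η : 0ℚ < η) A B A∈ B∈ → δ ≡ η →
        position δ 0<δ A A∈ ≡ position η 0<η B B∈ → A ≡ B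
      position-injective δ _ 0<δ 0<η A B A∈ B∈ refl = go 0<η B∈ (ℚ.<-irrelevant 0<δ 0<η)
        where
        go : ∀ 0<η B∈ → 0<δ ≡ 0<η → position δ 0<δ A A∈ ≡ position δ 0<η B B∈ → A ≡ B
        go _ B∈ refl = index-injective
          (proj₂ (class-finite δ 0<δ) A A∈)
          (proj₂ (class-finite δ 0<δ) B B∈)

      -- The classification is found from `A` alone, so the code is independent of the proof of
      -- membership in `ℬ`. The value `0` never occurs on `ℬ`, whose members are all classified.
      code : ∀ A → Classified A ⊎ ¬ Classified A → ℕ
      code A (inj₁ (δ , 0<δ , A∈)) = pair (codeℚ δ) (position δ 0<δ A A∈)
      code A (inj₂ _)              = 0

      code-injective : ∀ A B → A ∈ ℬ → B ∈ ℬ → ∀ p q → code A p ≡ code B q → A ≡ B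
      code-injective A B A∈ℬ B∈ℬ (inj₂ ¬c) _ _ = ⊥-elim (¬c (classified A∈ℬ))
      code-injective A B A∈ℬ B∈ℬ (inj₁ _) (inj₂ ¬c) _ = ⊥-elim (¬c (classified B∈ℬ))
      code-injective A B _ _ (inj₁ (δ , 0<δ , A∈)) (inj₁ (η , 0<η , B∈)) e =
        let e₁ , e₂ = pair-injective
              (codeℚ δ) (position δ 0<δ A A∈) (codeℚ η) (position η 0<η B B∈) e
        in position-injective δ η 0<δ 0<η A B A∈ B∈ (codeℚ-injective δ η e₁) e₂

    ℬ-countable : AtMostCountable ℬ
    ℬ-countable = record
      { to        = λ (A , _) → code A (decide (Classified A))
      ; cong      = λ A≗B → cong (λ A → code A (decide (Classified A))) (ext A≗B)
      ; injective = λ { {A , A∈ℬ} {B , B∈ℬ} e n →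
          cong (λ C → C n)
            (code-injective A B A∈ℬ B∈ℬ (decide (Classified A)) (decide (Classified B)) e) }
      }

    -- Around any other `x`, all members of `ℬ` with density near `x` fall into one class. The class
    -- is finite, so densities different from `x` keep a positive distance from it.
    accumulation : d[ ℬ ] ′ ⊆ ｛0,1｝
    accumulation {x} acc =
      [ inj₁ , (λ x≉0 → [ inj₂ , (λ x≉1 → ⊥-elim (impossible x≉0 x≉1)) ]′ (decide (x ≈ᴿ 1ᴿ))) ]′
        (decide (x ≈ᴿ 0ᴿ))
      where
      eq₁ : ∀ r → 1ℚ - r ≡ (1ℚ - r) - 0ℚ
      eq₁ = solve-∀ ℚ-ring
      eq₂ : ∀ r → r ≡ 1ℚ - (1ℚ - r)
      eq₂ = solve-∀ ℚ-ring
      1-x≋0 : const 1ℚ ⊖ seq x ≋ const 0ℚ → seq x ≋ const 1ℚ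
      1-x≋0 h = ≋-trans (≗⇒≋ λ n → eq₂ (seq x n)) (≋-− (≋-refl {const 1ℚ}) h)

      isolated-member : ∀ {η ε} L → (∀ A → Class η A → A ∈ˡ L) →
        (∀ A → A ∈ˡ L → ¬ (ρ A ≋ seq x) → ¬ Close (ρ A) (seq x) ε) →
        (∀ A → A ∈ ℬ → Close (ρ A) (seq x) η → Class η A) →
        ∀ A y → A ∈ ℬ → ρ A ≋ seq y → ¬ (y ≈ᴿ x) → ¬ Close (seq y) (seq x) (η ⊓ ε)
      isolated-member {η} {ε} L complete iso classify A y A∈ℬ ρ≋y y≉x close-y =
        iso A (complete A (classify A A∈ℬ (close-≤ (ℚ.p⊓q≤p η ε) close)))
          (λ ρ≋x → y≉x (≋⇒∣-∣ (≋-trans (≋-sym ρ≋y) ρ≋x)))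
          (close-≤ (ℚ.p⊓q≤q η ε) close)
        where
        close : Close (ρ A) (seq x) (η ⊓ ε)
        close = close-≋ (≋-sym ρ≋y) close-y

      -- The lower bound comes from `x` being away from `0`, the upper one from the same fact about
      -- `1 - x` and `1 - ρ A`.
      classify : ∀ {η₀ η₁} →
        (∀ v → const 0ℚ ≾ v → Close v (seq x) η₀ → const η₀ ≾ v) →
        (∀ v → const 0ℚ ≾ v → Close v (const 1ℚ ⊖ seq x) η₁ → const η₁ ≾ v) →
        ∀ A → A ∈ ℬ → Close (ρ A) (seq x) (η₀ ⊓ η₁) → Class (η₀ ⊓ η₁) A
      classify {η₀} {η₁} away₀ away₁ A A∈ℬ close =
        A∈ℬ ,
        ≾-trans (≤⇒≾ λ _ → ℚ.p⊓q≤p η₀ η₁) (away₀ (ρ A) (≤⇒≾ (proj₁ ∘ unit-ρ A))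
          (close-≤ (ℚ.p⊓q≤p η₀ η₁) close)) ,
        ≾-trans (≤⇒≾ λ n → ℚ.≤-reflexive (eq₂ (ρ A n))) (≾-− (≾-refl {const 1ℚ}) η≾1-ρ)
        where
        η≾1-ρ : const (η₀ ⊓ η₁) ≾ const 1ℚ ⊖ ρ A
        η≾1-ρ = ≾-trans (≤⇒≾ λ _ → ℚ.p⊓q≤q η₀ η₁) (away₁ (const 1ℚ ⊖ ρ A)
          (≤⇒≾ λ n → ≤-by (proj₂ (unit-ρ A n)) (eq₁ (ρ A n)))
          (close-1- (close-≤ (ℚ.p⊓q≤q η₀ η₁) close)))

      contradict :
        (∃ λ η → 0ℚ < η × ∀ v → const 0ℚ ≾ v → Close v (seq x) η → const η ≾ v) →
        (∃ λ η → 0ℚ < η × ∀ v → const 0ℚ ≾ v → Close v (const 1ℚ ⊖ seq x) η → const η ≾ v) →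
        ⊥
      contradict (η₀ , 0<η₀ , away₀) (η₁ , 0<η₁ , away₁) = within-class
        (class-finite (η₀ ⊓ η₁) (0<⊓ 0<η₀ 0<η₁))
        where
        near : ∀ {ε} L → (∀ A → Class (η₀ ⊓ η₁) A → A ∈ˡ L) → 0ℚ < ε →
          (∀ A → A ∈ˡ L → ¬ (ρ A ≋ seq x) → ¬ Close (ρ A) (seq x) ε) → ⊥
        near {ε} L complete 0<ε iso =
          -- Within `η₀` and `η₁` the set `A` falls into the finite class; within `ε` it contradicts
          -- isolation.
          let y , (A , A∈ℬ , d) , y≉x , y-x<ε = acc (fromℚ ((η₀ ⊓ η₁) ⊓ ε))
                (0<fromℚ (0<⊓ (0<⊓ 0<η₀ 0<η₁) 0<ε))
          in isolated-member L complete iso (classify away₀ away₁)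
               A y A∈ℬ (hasDensity⇒≋ {A} {y} d) y≉x (<ᴿ⇒close y x ((η₀ ⊓ η₁) ⊓ ε) y-x<ε)
        within-class : (∃ λ L → ∀ A → Class (η₀ ⊓ η₁) A → A ∈ˡ L) → ⊥
        within-class (L , complete) =
          let ε , 0<ε , iso = isolated (seq x) L in near L complete 0<ε iso

      impossible : ¬ (x ≈ᴿ 0ᴿ) → ¬ (x ≈ᴿ 1ᴿ) → ⊥
      impossible x≉0 x≉1 = contradict
        (away-from-0 (cauchy x) (x≉0 ∘ ≋⇒∣-∣))
        (away-from-0 (cauchy (1ᴿ -ᴿ x)) (x≉1 ∘ ≋⇒∣-∣ ∘ 1-x≋0))

theorem2p6 : ExcludedMiddle 0ℓ → Extensionality 0ℓ 0ℓ →
    (S : Pred ℝ 0ℓ) → S Respects _≈ᴿ_ → Satisfiable S → S ⊆ ⟨0,1⟩ →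
    ∃₂ λ (𝒜 ℬ : Family) →
    IsMaximalDIndependent 𝒜 × HasCardinality𝔠 𝒜 ×
    ℬ ⊆ 𝒜 × AtMostCountable ℬ ×
    d[ 𝒜 ∖ ℬ ] ≐ S × d[ ℬ ] ′ ⊆ ｛0,1｝
theorem2p6 em ext S S-resp (s₀ , s₀∈S) S⊆⟨0,1⟩ =
  𝒜 , ℬ , 𝒜-isMaximal , 𝒜-cardinality , proj₁ , ℬ-countable , density-𝒜∖ℬ , λ {x} → accumulation {x}
  where
  open Construction.MaximalFamily em ext S (λ {x} {y} → S-resp {x} {y})
    s₀ s₀∈S (λ {x} → S⊆⟨0,1⟩ {x})
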